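{- For every nonempty signed graph $\Sigma$, $$\overline{\vartheta}_{\mathrm b}(\Sigma)=\tfrac12\,\overline{\vartheta}(C(\Sigma)),$$ where $C(\Sigma)$ is the conflict graph of $\Sigma$.
   Context: Signed graphs. A signed graph is a pair $\Sigma=(G,\sigma)$ with $G$ a finite graph and $\sigma:E(G)\to\{+1,-1\}$. Positive loops are allowed, negative loops are excluded; between two distinct vertices there may be both a positive and a negative edge (a digon); repeated edges of the same sign are immaterial. Convention: every signed graph is replaced by its completion having a positive loop at every vertex. Signed homomorphism. A signed homomorphism $\Sigma\to\Pi$ consists of a switching function $\tau:V(\Sigma)\to\{\pm1\}$ and a vertex map $f:V(\Sigma)\to V(\Pi)$ such that for every edge $e=uv$ of $\Sigma$ the signed graph $\Pi$ contains an edge between $f(u)$ and $f(v)$ of sign $\tau(u)\sigma(e)\tau(v)$. Signed sphere. Let $\mathcal H=\mathcal H_+\oplus\mathcal H_-$ be a finite-dimensional real inner-product space (orthogonal direct sum) and $R(a,b)=(a,-b)$. For $t\ge1$ put $\gamma_t=\frac1{1-2t}$. The (infinite) signed graph $\mathcal S_t(\mathcal H,R)$ has vertex set $\{x\in\mathcal H:\|x\|=1,\ \langle x,Rx\rangle=\gamma_t\}$; $x,y$ are joined by a negative edge iff $\langle x,y\rangle=\gamma_t$, and by a positive edge iff $\langle x,Ry\rangle=\gamma_t$ (both may hold; $x=y$ allowed). Balanced theta parameter. For nonempty $\Sigma$ (with positive loops adjoined), $\overline{\vartheta}_{\mathrm b}(\Sigma)=\inf\{t\ge1:\text{there is a signed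 homomorphism }\Sigma\to\mathcal S_t(\mathcal H,R)\text{ for some finite-dimensional }\mathcal H=\mathcal H_+\oplus\mathcal H_-\}$. Conflict graph. $C(\Sigma)$ is the ordinary simple graph on $V(\Sigma)\times\{\pm1\}$ with $(u,s)\sim(v,r)$ iff there is an edge $e=uv$ of $\Sigma$ (possibly a loop, $u=v$) with $r=-\sigma(e)s$. In particular $(v,+)\sim(v,-)$ for all $v$ because of the positive loops. Ordinary theta. For a nonempty finite simple graph $H$, $\overline{\vartheta}(H)=\vartheta(\overline H)$ is the Lovász theta number of the complement; equivalently, it is the minimum $\lambda\in\mathbb R$ such that there is a real symmetric $M\succeq0$ indexed by $V(H)$ with $M_{vv}=\lambda-1$ for all $v$ and $M_{uv}=-1$ for all $uv\in E(H)$. -}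

module Defs where

open import Level using (0ℓ)
open import Algebra.Bundles using (CommutativeRing)
open import Algebra.Module.Bundles using (LeftModule)
import Algebra.Properties.CommutativeMonoid.Sum as Sum
import Algebra.Properties.Ring as RingProperties
open import Data.Fin.Base using (Fin; zero; suc)
open import Data.Fin.Properties using (*↔×)
open import Data.Nat.Base as ℕ using (ℕ)
open import Data.Product using (Σ; ∃; ∃₂; _×_; _,_)
open import Data.Product.Function.NonDependent.Propositional using (_×-↔_)
open import Data.Sign.Base using (Sign; opposite) renaming (+ to pos; - to neg; _*_ to _·_)
open import Data.Sum.Base as Sum′ using (_⊎_; inj₁; inj₂)
open import Function.Bundles using (_↔_; mk↔ₛ′; Inverse)
open import Function.Construct.Composition using (_↔-∘_)
open import Relation.Binary.Core using (Rel)
open import Relation.Binary.PropositionalEquality.Core as ≡ using (_≡_)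
open import Relation.Binary.Structures using (IsTotalOrder)
open import Relation.Nullary.Negation.Core using (¬_)
import Relation.Binary.Reasoning.Setoid as SetoidReasoning

-- The real numbers are characterised, up to unique isomorphism, as the
-- Dedekind-complete ordered field.  Completeness for arbitrary predicates
-- is a classical principle, so results about this structure are stated
-- under excluded middle.

record CompleteOrderedField : Set₁ where
  infix  4 _≤_
  infix  8 _⁻¹
  field
    commutativeRing : CommutativeRing 0ℓ 0ℓ

  open CommutativeRing commutativeRing public

  field
    _≤_          : Rel Carrier 0ℓ
    isTotalOrder : IsTotalOrder _≈_ _≤_
    +-monoˡ-≤    : ∀ {x y} z → x ≤ y → x + z ≤ y + z
    *-nonneg     : ∀ {x y} → 0# ≤ x → 0# ≤ y → 0# ≤ x * y
    0≉1          : ¬ 0# ≈ 1#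
    -- The value of 0# ⁻¹ is left unspecified.
    _⁻¹          : Carrier → Carrier
    *-inverseʳ   : ∀ {x} → ¬ x ≈ 0# → x * x ⁻¹ ≈ 1#
    supremum     : (P : Carrier → Set) → ∃ P →
                   (∃ λ u → ∀ x → P x → x ≤ u) →
                   ∃ λ s → (∀ x → P x → x ≤ s) ×
                           (∀ u → (∀ x → P x → x ≤ u) → s ≤ u)

  2# : Carrier
  2# = 1# + 1#

  ½ : Carrier
  ½ = 2# ⁻¹

  IsInfimum : ∀ {ℓ} → (Carrier → Set ℓ) → Carrier → Set ℓ
  IsInfimum P m = (∀ x → P x → m ≤ x) × (∀ l → (∀ x → P x → l ≤ x) → l ≤ m)

  IsMinimum : ∀ {ℓ} → (Carrier → Set ℓ) → Carrier → Set ℓ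
  IsMinimum P m = P m × (∀ x → P x → m ≤ x)

  open IsTotalOrder isTotalOrder public
    using (total; antisym; ≤-respˡ-≈; ≤-respʳ-≈)
    renaming (trans to ≤-trans; reflexive to ≤-reflexive)
  open RingProperties ring public using (-‿distribˡ-*; -‿involutive)

  +-monoʳ-≤ : ∀ {x y} z → x ≤ y → z + x ≤ z + y
  +-monoʳ-≤ z x≤y =
    ≤-respˡ-≈ (+-comm _ z) (≤-respʳ-≈ (+-comm _ z) (+-monoˡ-≤ z x≤y))

  +-cancelˡ-≤ : ∀ z {x y} → z + x ≤ z + y → x ≤ y
  +-cancelˡ-≤ z h = ≤-respˡ-≈ (strip _) (≤-respʳ-≈ (strip _) (+-monoʳ-≤ (- z) h))
    where
    strip : ∀ x → - z + (z + x) ≈ x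
    strip x = trans (sym (+-assoc _ _ _))
                    (trans (+-congʳ (-‿inverseˡ z)) (+-identityˡ x))

  0≤1 : 0# ≤ 1#
  0≤1 with total 0# 1#
  ... | inj₁ 0≤1 = 0≤1
  ... | inj₂ 1≤0 = ≤-respʳ-≈ -1*-1≈1 (*-nonneg 0≤-1 0≤-1)
    where
    0≤-1 : 0# ≤ - 1#
    0≤-1 = +-cancelˡ-≤ 1#
      (≤-respˡ-≈ (sym (+-identityʳ 1#)) (≤-respʳ-≈ (sym (-‿inverseʳ 1#)) 1≤0))
    -1*-1≈1 : - 1# * - 1# ≈ 1#
    -1*-1≈1 = trans (sym (-‿distribˡ-* 1# (- 1#)))
                    (trans (-‿cong (*-identityˡ (- 1#))) (-‿involutive 1#))

  1≰0 : ¬ 1# ≤ 0#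
  1≰0 1≤0 = 0≉1 (antisym 0≤1 1≤0)

record Finite (V : Set) : Set where
  field
    size : ℕ
    enum : Fin size ↔ V

  element : Fin size → V
  element = Inverse.to enum

record SimpleGraph : Set₁ where
  field
    V         : Set
    Adj       : V → V → Set
    symmetric : ∀ {u v} → Adj u v → Adj v u
    loopless  : ∀ {v} → ¬ Adj v v

-- `Edge s u v` says that there is an edge of sign s between u and v.
-- Since repeated edges of the same sign are immaterial, this is all the
-- information carried by a pair (G , σ).  The vertex set may be infinite.

record SignedGraph : Set₁ where
  field
    V                : Set
    Edge             : Sign → V → V → Set
    symmetric        : ∀ {s u v} → Edge s u v → Edge s v u
    no-negative-loop : ∀ {v} → ¬ Edge neg v v

completion : SignedGraph → SignedGraph
completion G = record
  { V                = V
  ; Edge             = λ s u v → Edge s u v ⊎ (s ≡ pos × u ≡ v)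
  ; symmetric        = Sum′.map symmetric (λ (p , q) → p , ≡.sym q)
  ; no-negative-loop = λ { (inj₁ e) → no-negative-loop e ; (inj₂ (() , _)) }
  }
  where open SignedGraph G

record SignedHomomorphism (G H : SignedGraph) : Set where
  private
    module G = SignedGraph G
    module H = SignedGraph H
  field
    τ         : G.V → Sign
    f         : G.V → H.V
    preserves : ∀ {s u v} → G.Edge s u v → H.Edge (τ u · s · τ v) (f u) (f v)

-- The conflict graph is formed from the completion.

conflictGraph : SignedGraph → SimpleGraph
conflictGraph G = record
  { V         = V × Sign
  ; Adj       = Adj
  ; symmetric = λ { {_ , s} {_ , r} (σ , e , p) →
                    σ , symmetric e , flip σ s r p }
  ; loopless  = λ { {_ , s} (σ , e , p) → loopless σ s p e }
  }
  where
  open SignedGraph (completion G)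

  Adj : V × Sign → V × Sign → Set
  Adj (u , s) (v , r) = ∃ λ σ → Edge σ u v × r ≡ opposite σ · s

  flip : ∀ σ s r → r ≡ opposite σ · s → s ≡ opposite σ · r
  flip pos pos _ ≡.refl = ≡.refl
  flip pos neg _ ≡.refl = ≡.refl
  flip neg pos _ ≡.refl = ≡.refl
  flip neg neg _ ≡.refl = ≡.refl

  loopless : ∀ σ s → s ≡ opposite σ · s → ∀ {v} → ¬ Edge σ v v
  loopless neg _ _ e  = no-negative-loop e
  loopless pos pos () _
  loopless pos neg () _

Sign-enum : Fin 2 ↔ Sign
Sign-enum = mk↔ₛ′
  (λ { zero → pos ; (suc zero) → neg })
  (λ { pos → zero ; neg → suc zero })
  (λ { pos → ≡.refl ; neg → ≡.refl })
  (λ { zero → ≡.refl ; (suc zero) → ≡.refl })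

×Sign-finite : {V : Set} → Finite V → Finite (V × Sign)
×Sign-finite fin = record
  { size = size ℕ.* 2
  ; enum = (enum ×-↔ Sign-enum) ↔-∘ *↔×
  }
  where open Finite fin

module _ (ℝ : CompleteOrderedField) where
  open CompleteOrderedField ℝ
  open Sum +-commutativeMonoid using (sum)

  module _ {V : Set} (finite : Finite V) where
    open Finite finite

    ∑ : (V → Carrier) → Carrier
    ∑ g = sum (λ i → g (element i))

    record PositiveSemidefinite (M : V → V → Carrier) : Set where
      field
        symmetric : ∀ u v → M u v ≈ M v u
        nonneg    : ∀ (x : V → Carrier) →
                    0# ≤ ∑ (λ u → ∑ (λ v → x u * M u v * x v))

  module _ (H : SimpleGraph) (finite : Finite (SimpleGraph.V H)) where
    open SimpleGraph H

    ThetaFeasible : Carrier → Set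
    ThetaFeasible l = ∃ λ (M : V → V → Carrier) →
      PositiveSemidefinite finite M ×
      (∀ v → M v v ≈ l - 1#) ×
      (∀ {u v} → Adj u v → M u v ≈ - 1#)

    -- ϑ of the complement of H, as the optimal value of the semidefinite
    -- program; the minimum is required to be attained.
    IsComplementTheta : Carrier → Set
    IsComplementTheta = IsMinimum ThetaFeasible

  record InnerProductSpace : Set₁ where
    field
      vectorSpace : LeftModule ring 0ℓ 0ℓ

    open LeftModule vectorSpace public

    field
      ⟨_,_⟩    : Carrierᴹ → Carrierᴹ → Carrier
      ⟨⟩-cong  : ∀ {x x′ y y′} → x ≈ᴹ x′ → y ≈ᴹ y′ → ⟨ x , y ⟩ ≈ ⟨ x′ , y′ ⟩
      ⟨⟩-sym   : ∀ x y → ⟨ x , y ⟩ ≈ ⟨ y , x ⟩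
      ⟨⟩-+     : ∀ x y z → ⟨ x +ᴹ y , z ⟩ ≈ ⟨ x , z ⟩ + ⟨ y , z ⟩
      ⟨⟩-*     : ∀ a x y → ⟨ a *ₗ x , y ⟩ ≈ a * ⟨ x , y ⟩
      nonneg   : ∀ x → 0# ≤ ⟨ x , x ⟩
      definite : ∀ x → ⟨ x , x ⟩ ≈ 0# → x ≈ᴹ 0ᴹ
      -- Finite-dimensionality, as the existence of a finite spanning family.
      spanSize     : ℕ
      spanning     : Fin spanSize → Carrierᴹ
      coefficients : ∀ x → ∃ λ (c : Fin spanSize → Carrier) →
        x ≈ᴹ Sum.sum +ᴹ-commutativeMonoid (λ i → c i *ₗ spanning i)

    private
      ⟨⟩-neg′ : ∀ x y → ⟨ -ᴹ x , y ⟩ ≈ - ⟨ x , y ⟩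
      ⟨⟩-neg′ x y = begin
        a                  ≈⟨ +-identityʳ a ⟨
        a + 0#             ≈⟨ +-congˡ (-‿inverseʳ b) ⟨
        a + (b - b)        ≈⟨ +-assoc a b (- b) ⟨
        a + b - b          ≈⟨ +-congʳ (⟨⟩-+ (-ᴹ x) x y) ⟨
        ⟨ -ᴹ x +ᴹ x , y ⟩ - b  ≈⟨ +-congʳ (⟨⟩-cong (-ᴹ‿inverseˡ x) ≈ᴹ-refl) ⟩
        ⟨ 0ᴹ , y ⟩ - b      ≈⟨ +-congʳ (⟨⟩-cong (*ₗ-zeroˡ 0ᴹ) ≈ᴹ-refl) ⟨
        ⟨ 0# *ₗ 0ᴹ , y ⟩ - b ≈⟨ +-congʳ (⟨⟩-* 0# 0ᴹ y) ⟩
        0# * ⟨ 0ᴹ , y ⟩ - b ≈⟨ +-congʳ (zeroˡ _) ⟩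
        0# - b             ≈⟨ +-identityˡ (- b) ⟩
        - b                ∎
        where
        open SetoidReasoning setoid
        a = ⟨ -ᴹ x , y ⟩
        b = ⟨ x , y ⟩

    ⟨⟩-negʳ : ∀ x y → ⟨ x , -ᴹ y ⟩ ≈ - ⟨ x , y ⟩
    ⟨⟩-negʳ x y = trans (⟨⟩-sym x (-ᴹ y)) (trans (⟨⟩-neg′ y x) (-‿cong (⟨⟩-sym y x)))

  γ : Carrier → Carrier
  γ t = (1# - 2# * t) ⁻¹

  γ≉1 : ∀ {t} → 1# ≤ t → ¬ γ t ≈ 1#
  γ≉1 {t} 1≤t γ≈1 = d≉1 d≈1
    where
    open SetoidReasoning setoid
    d = 1# - 2# * t

    2t≈ : 2# * t ≈ t + t
    2t≈ = trans (distribʳ t 1# 1#) (+-cong (*-identityˡ t) (*-identityˡ t))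

    +2t : d + (t + t) ≈ 1#
    +2t = begin
      d + (t + t)               ≈⟨ +-congˡ 2t≈ ⟨
      (1# - 2# * t) + 2# * t    ≈⟨ +-assoc _ _ _ ⟩
      1# + (- (2# * t) + 2# * t) ≈⟨ +-congˡ (-‿inverseˡ _) ⟩
      1# + 0#                   ≈⟨ +-identityʳ 1# ⟩
      1#                        ∎

    t≰0 : ¬ t ≤ 0#
    t≰0 t≤0 = 1≰0 (≤-trans 1≤t t≤0)

    d≉0 : ¬ d ≈ 0#
    d≉0 d≈0 = t≰0 (+-cancelˡ-≤ t
      (≤-respˡ-≈ (sym 2t≈1) (≤-respʳ-≈ (sym (+-identityʳ t)) 1≤t)))
      where
      2t≈1 : t + t ≈ 1#
      2t≈1 = trans (sym (+-identityˡ _)) (trans (+-congʳ (sym d≈0)) +2t)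

    d≉1 : ¬ d ≈ 1#
    d≉1 d≈1 = t≰0 (≤-trans
      (≤-respˡ-≈ (+-identityʳ t) (+-monoʳ-≤ t (≤-trans 0≤1 1≤t)))
      (+-cancelˡ-≤ 1# (≤-reflexive
        (trans (+-congʳ (sym d≈1)) (trans +2t (sym (+-identityʳ 1#)))))))

    d≈1 : d ≈ 1#
    d≈1 = trans (sym (*-identityʳ d)) (trans (*-congˡ (sym γ≈1)) (*-inverseʳ d≉0))

  -- 𝓗 = 𝓗₊ ⊕ 𝓗₋ is the orthogonal direct sum, realised as pairs.

  module OrthogonalSum (H₊ H₋ : InnerProductSpace) where
    private
      module H₊ = InnerProductSpace H₊
      module H₋ = InnerProductSpace H₋

    𝓗 : Set
    𝓗 = H₊.Carrierᴹ × H₋.Carrierᴹ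

    ⟪_,_⟫ : 𝓗 → 𝓗 → Carrier
    ⟪ (a , b) , (c , d) ⟫ = H₊.⟨ a , c ⟩ + H₋.⟨ b , d ⟩

    R : 𝓗 → 𝓗
    R (a , b) = a , H₋.-ᴹ b

    -- ‖ x ‖≈ r says that r is the nonnegative square root of ⟪ x , x ⟫.
    ‖_‖≈_ : 𝓗 → Carrier → Set
    ‖ x ‖≈ r = 0# ≤ r × r * r ≈ ⟪ x , x ⟫

    ⟪⟫-sym : ∀ x y → ⟪ x , y ⟫ ≈ ⟪ y , x ⟫
    ⟪⟫-sym (a , b) (c , d) = +-cong (H₊.⟨⟩-sym a c) (H₋.⟨⟩-sym b d)

    R-selfAdjoint : ∀ x y → ⟪ x , R y ⟫ ≈ ⟪ y , R x ⟫
    R-selfAdjoint (a , b) (c , d) = +-cong (H₊.⟨⟩-sym a c)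
      (trans (H₋.⟨⟩-negʳ b d)
             (trans (-‿cong (H₋.⟨⟩-sym b d)) (sym (H₋.⟨⟩-negʳ d b))))

  signedSphere : ∀ t → 1# ≤ t → (H₊ H₋ : InnerProductSpace) → SignedGraph
  signedSphere t 1≤t H₊ H₋ = record
    { V                = Vertex
    ; Edge             = Edge
    ; symmetric        = λ {s} → symmetric s
    ; no-negative-loop = λ { {_ , (_ , 1≈) , _} e →
        γ≉1 1≤t (trans (sym e) (trans (sym 1≈) (*-identityˡ 1#))) }
    }
    where
    open OrthogonalSum H₊ H₋

    Vertex : Set
    Vertex = ∃ λ (x : 𝓗) → ‖ x ‖≈ 1# × ⟪ x , R x ⟫ ≈ γ t

    Edge : Sign → Vertex → Vertex → Set
    Edge neg (x , _) (y , _) = ⟪ x , y ⟫ ≈ γ t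
    Edge pos (x , _) (y , _) = ⟪ x , R y ⟫ ≈ γ t

    symmetric : ∀ s {x y} → Edge s x y → Edge s y x
    symmetric neg {x , _} {y , _} e = trans (⟪⟫-sym y x) e
    symmetric pos {x , _} {y , _} e = trans (R-selfAdjoint y x) e

  BalancedFeasible : SignedGraph → Carrier → Set₁
  BalancedFeasible G t =
    Σ (1# ≤ t) λ 1≤t → ∃₂ λ (H₊ H₋ : InnerProductSpace) →
      SignedHomomorphism (completion G) (signedSphere t 1≤t H₊ H₋)

  IsBalancedTheta : SignedGraph → Carrier → Set₁
  IsBalancedTheta G = IsInfimum (BalancedFeasible G)

{-# OPTIONS --safe #-}
module Submission where

-- A homomorphism v ↦ x_v with switching τ turns into the unit vectors
-- y_(v,s) = R^[sτ(v) = −] x_v, whose inner product is γ_t along every edge of the conflict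
-- graph; their Gram matrix scaled by 2t − 1 is therefore feasible for the theta program
-- with value 2t.  Conversely, a feasible M may be averaged over the automorphism
-- (v , s) ↦ (v , −s), after which it splits into an even and an odd positive semidefinite
-- block; these are the Gram matrices of the components of x_v in 𝓗₊ and 𝓗₋, with τ = 1.
-- Hence t is feasible for Σ exactly if 2t is feasible for C(Σ).
--
-- The theta program attains its minimum because the entries of feasible matrices are
-- bounded by the diagonal: near-optimal matrices have a cluster point, found one
-- coordinate at a time as a limit inferior, and the constraints are closed.

open import Defs
open import Level using (0ℓ)
open import Axiom.ExcludedMiddle using (ExcludedMiddle)
open import Data.Product using (∃; ∃₂; _×_; _,_; proj₁; proj₂)

open import Algebra.Bundles using (CommutativeRing)
import Algebra.Properties.AbelianGroup as AbelianGroupProperties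
import Algebra.Properties.Ring as RingProperties
import Algebra.Properties.Semiring.Mult.TCOptimised as Multiple
import Algebra.Properties.Semiring.Sum as SemiringSum
import Algebra.Solver.Ring as RingSolver
open import Algebra.Solver.Ring.AlmostCommutativeRing
  using (fromCommutativeRing; _-Raw-AlmostCommutative⟶_)
open import Data.Fin.Base using (Fin; zero; suc; remQuot; combine)
open import Data.Fin.Properties using (remQuot-combine)
open import Data.Integer.Base as ℤ using (ℤ; +_; -[1+_])
import Data.Integer.Properties as ℤ
open import Data.Maybe.Base using (Maybe; just; nothing)
open import Data.Nat.Base as ℕ using (ℕ; zero; suc)
import Data.Nat.Properties as ℕ
open import Data.Sign.Base using (Sign; opposite) renaming (+ to pos; - to neg; _*_ to _·_)
open import Data.Sum.Base using (inj₁; inj₂)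
open import Data.Vec.Functional using (foldr)
open import Function.Bundles using (Inverse)
open import Function.Construct.Identity using (↔-id)
open import Relation.Binary.PropositionalEquality.Core as ≡ using (_≡_)
import Relation.Binary.Reasoning.Setoid as SetoidReasoning
open import Relation.Nullary using (¬_; yes; no; contradiction)

-- A ring solver with integer coefficients for any commutative ring.

-- Integer coefficients, unlike coefficients in the ring itself, have decidable
-- equality, so the solver can cancel.

module IntegerCoefficients {c ℓ} (R : CommutativeRing c ℓ) where
  open CommutativeRing R
  open RingProperties ring
  open AbelianGroupProperties +-abelianGroup using (⁻¹-∙-comm)
  open Multiple semiring using (1+×; ×-homo-+; ×1-homo-*) renaming (_×_ to _⋆_)
  open SetoidReasoning setoid

  -- With the optimised multiple, `0 ⋆ 1#` and `1 ⋆ 1#` compute to `0#` and `1#`, so the constants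
  -- `con (+ 0)` and `con (+ 1)` match those of the field on the nose.
  fromℤ : ℤ → Carrier
  fromℤ (+ n)    = n ⋆ 1#
  fromℤ -[1+ n ] = - (suc n ⋆ 1#)

  fromℤ-neg : ∀ i → fromℤ (ℤ.- i) ≈ - fromℤ i
  fromℤ-neg (+ zero)  = sym -0#≈0#
  fromℤ-neg (+ suc n) = refl
  fromℤ-neg -[1+ n ]  = sym (-‿involutive _)

  fromℤ-⊖ : ∀ m n → fromℤ (m ℤ.⊖ n) ≈ m ⋆ 1# - n ⋆ 1#
  fromℤ-⊖ m zero = sym (trans (+-congˡ -0#≈0#) (+-identityʳ _))
  fromℤ-⊖ zero (suc n) = sym (+-identityˡ _)
  fromℤ-⊖ (suc m) (suc n) = begin
    fromℤ (suc m ℤ.⊖ suc n)         ≡⟨ ≡.cong fromℤ (ℤ.[1+m]⊖[1+n]≡m⊖n m n) ⟩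
    fromℤ (m ℤ.⊖ n)                 ≈⟨ fromℤ-⊖ m n ⟩
    a - b                           ≈⟨ +-congʳ (+-identityˡ a) ⟨
    0# + a - b                      ≈⟨ +-congʳ (+-congʳ (-‿inverseˡ 1#)) ⟨
    - 1# + 1# + a - b               ≈⟨ +-congʳ (+-assoc _ _ _) ⟩
    - 1# + (1# + a) - b             ≈⟨ +-congʳ (+-comm _ _) ⟩
    1# + a - 1# - b                 ≈⟨ +-assoc _ _ _ ⟩
    1# + a + (- 1# - b)             ≈⟨ +-congˡ (⁻¹-∙-comm 1# b) ⟩
    1# + a - (1# + b)               ≈⟨ +-cong (1+× m 1#) (-‿cong (1+× n 1#)) ⟨
    suc m ⋆ 1# - suc n ⋆ 1#         ∎
    where
    a = m ⋆ 1#
    b = n ⋆ 1#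

  fromℤ-+ : ∀ i j → fromℤ (i ℤ.+ j) ≈ fromℤ i + fromℤ j
  fromℤ-+ (+ m)    (+ n)    = ×-homo-+ 1# m n
  fromℤ-+ (+ m)    -[1+ n ] = fromℤ-⊖ m (suc n)
  fromℤ-+ -[1+ m ] (+ n)    = trans (fromℤ-⊖ n (suc m)) (+-comm _ _)
  fromℤ-+ -[1+ m ] -[1+ n ] = begin
    - ((2 ℕ.+ (m ℕ.+ n)) ⋆ 1#)          ≡⟨ ≡.cong (λ k → - (suc k ⋆ 1#)) (≡.sym (ℕ.+-suc m n)) ⟩
    - ((suc m ℕ.+ suc n) ⋆ 1#)          ≈⟨ -‿cong (×-homo-+ 1# (suc m) (suc n)) ⟩
    - (suc m ⋆ 1# + suc n ⋆ 1#)         ≈⟨ ⁻¹-∙-comm _ _ ⟨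
    - (suc m ⋆ 1#) - suc n ⋆ 1#         ∎

  fromℤ-+* : ∀ m j → fromℤ (+ m ℤ.* j) ≈ m ⋆ 1# * fromℤ j
  fromℤ-+* m (+ n) = begin
    fromℤ (+ m ℤ.* + n)             ≡⟨ ≡.cong fromℤ (ℤ.pos-* m n) ⟨
    (m ℕ.* n) ⋆ 1#                  ≈⟨ ×1-homo-* m n ⟩
    m ⋆ 1# * (n ⋆ 1#)               ∎
  fromℤ-+* m -[1+ n ] = begin
    fromℤ (+ m ℤ.* ℤ.- + suc n)     ≡⟨ ≡.cong fromℤ (ℤ.neg-distribʳ-* (+ m) (+ suc n)) ⟨
    fromℤ (ℤ.- (+ m ℤ.* + suc n))   ≈⟨ fromℤ-neg (+ m ℤ.* + suc n) ⟩
    - fromℤ (+ m ℤ.* + suc n)       ≈⟨ -‿cong (fromℤ-+* m (+ suc n)) ⟩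
    - (m ⋆ 1# * (suc n ⋆ 1#))       ≈⟨ -‿distribʳ-* _ _ ⟩
    m ⋆ 1# * - (suc n ⋆ 1#)         ∎

  fromℤ-* : ∀ i j → fromℤ (i ℤ.* j) ≈ fromℤ i * fromℤ j
  fromℤ-* (+ m) j = fromℤ-+* m j
  fromℤ-* -[1+ m ] j = begin
    fromℤ (ℤ.- + suc m ℤ.* j)       ≡⟨ ≡.cong fromℤ (ℤ.neg-distribˡ-* (+ suc m) j) ⟨
    fromℤ (ℤ.- (+ suc m ℤ.* j))     ≈⟨ fromℤ-neg (+ suc m ℤ.* j) ⟩
    - fromℤ (+ suc m ℤ.* j)         ≈⟨ -‿cong (fromℤ-+* (suc m) j) ⟩
    - (suc m ⋆ 1# * fromℤ j)        ≈⟨ -‿distribˡ-* _ _ ⟩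
    - (suc m ⋆ 1#) * fromℤ j        ∎

  morphism : CommutativeRing.rawRing ℤ.+-*-commutativeRing
             -Raw-AlmostCommutative⟶ fromCommutativeRing R
  morphism = record
    { ⟦_⟧    = fromℤ
    ; +-homo = fromℤ-+
    ; *-homo = fromℤ-*
    ; -‿homo = fromℤ-neg
    ; 0-homo = refl
    ; 1-homo = refl
    }

  coefficient≟ : ∀ i j → Maybe (fromℤ i ≈ fromℤ j)
  coefficient≟ i j with i ℤ.≟ j
  ... | yes i≡j = just (reflexive (≡.cong fromℤ i≡j))
  ... | no  _   = nothing

  open RingSolver _ (fromCommutativeRing R) morphism coefficient≟ public
    using (solve; _:+_; _:*_; _:-_; :-_; con; _:=_)

-- Inequalities in an ordered field.

module OrderedField (ℝ : CompleteOrderedField) where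
  open CompleteOrderedField ℝ hiding (zero)
  open IntegerCoefficients commutativeRing
  open SetoidReasoning setoid

  infix 4 0<_

  -- Strict positivity is a negation: it refutes `x ≈ 0#` before an inversion, and by totality it
  -- still yields `0# ≤ x`.
  0<_ : Carrier → Set
  0< x = ¬ x ≤ 0#

  ≤-refl : ∀ {x} → x ≤ x
  ≤-refl = ≤-reflexive refl

  ≰⇒≥ : ∀ {x y} → ¬ x ≤ y → y ≤ x
  ≰⇒≥ {x} {y} x≰y with total x y
  ... | inj₁ x≤y = contradiction x≤y x≰y
  ... | inj₂ y≤x = y≤x

  ≤-resp-≈ : ∀ {x x′ y y′} → x ≈ x′ → y ≈ y′ → x ≤ y → x′ ≤ y′
  ≤-resp-≈ x≈ y≈ x≤y = ≤-respˡ-≈ x≈ (≤-respʳ-≈ y≈ x≤y)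

  +-mono-≤ : ∀ {x y u v} → x ≤ y → u ≤ v → x + u ≤ y + v
  +-mono-≤ x≤y u≤v = ≤-trans (+-monoˡ-≤ _ x≤y) (+-monoʳ-≤ _ u≤v)

  +-nonneg : ∀ {x y} → 0# ≤ x → 0# ≤ y → 0# ≤ x + y
  +-nonneg 0≤x 0≤y = ≤-respˡ-≈ (+-identityˡ 0#) (+-mono-≤ 0≤x 0≤y)

  -- Splits an inequality into the sign of an explicit difference and an identity that the ring
  -- solver can settle.
  ≤-by-gap : ∀ {x y d} → 0# ≤ d → x + d ≈ y → x ≤ y
  ≤-by-gap 0≤d x+d≈y = ≤-resp-≈ (+-identityʳ _) x+d≈y (+-monoʳ-≤ _ 0≤d)

  x≤y⇒0≤y-x : ∀ {x y} → x ≤ y → 0# ≤ y - x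
  x≤y⇒0≤y-x {x} x≤y = ≤-respˡ-≈ (-‿inverseʳ x) (+-monoˡ-≤ (- x) x≤y)

  0≤y-x⇒x≤y : ∀ {x y} → 0# ≤ y - x → x ≤ y
  0≤y-x⇒x≤y {x} {y} 0≤y-x = ≤-by-gap 0≤y-x
    (solve 2 (λ x y → x :+ (y :- x) := y) refl x y)

  x≤0⇒0≤-x : ∀ {x} → x ≤ 0# → 0# ≤ - x
  x≤0⇒0≤-x x≤0 = ≤-respʳ-≈ (+-identityˡ _) (x≤y⇒0≤y-x x≤0)

  0≤-x⇒x≤0 : ∀ {x} → 0# ≤ - x → x ≤ 0#
  0≤-x⇒x≤0 0≤-x = 0≤y-x⇒x≤y (≤-respʳ-≈ (sym (+-identityˡ _)) 0≤-x)

  *-monoˡ-≤ : ∀ {x y} a → 0# ≤ a → x ≤ y → a * x ≤ a * y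
  *-monoˡ-≤ {x} {y} a 0≤a x≤y = ≤-by-gap (*-nonneg 0≤a (x≤y⇒0≤y-x x≤y))
    (solve 3 (λ a x y → a :* x :+ a :* (y :- x) := a :* y) refl a x y)

  square-nonneg : ∀ x → 0# ≤ x * x
  square-nonneg x with total 0# x
  ... | inj₁ 0≤x = *-nonneg 0≤x 0≤x
  ... | inj₂ x≤0 = ≤-respʳ-≈ (solve 1 (λ x → (:- x) :* (:- x) := x :* x) refl x)
    (*-nonneg (x≤0⇒0≤-x x≤0) (x≤0⇒0≤-x x≤0))

  1≤x⇒0<x : ∀ {x} → 1# ≤ x → 0< x
  1≤x⇒0<x 1≤x x≤0 = 1≰0 (≤-trans 1≤x x≤0)

  0<x⇒x≉0 : ∀ {x} → 0< x → ¬ x ≈ 0#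
  0<x⇒x≉0 0<x x≈0 = 0<x (≤-reflexive x≈0)

  1≤2 : 1# ≤ 2#
  1≤2 = ≤-by-gap 0≤1 refl

  0≤2 : 0# ≤ 2#
  0≤2 = ≤-trans 0≤1 1≤2

  0<2 : 0< 2#
  0<2 = 1≤x⇒0<x 1≤2

  -- If `x ⁻¹ ≤ 0#`, multiplication by `x` would give `1# ≤ 0#`.
  ⁻¹-nonneg : ∀ {x} → 0< x → 0# ≤ x ⁻¹
  ⁻¹-nonneg {x} 0<x with total 0# (x ⁻¹)
  ... | inj₁ 0≤x⁻¹ = 0≤x⁻¹
  ... | inj₂ x⁻¹≤0 = contradiction
    (≤-resp-≈ (*-inverseʳ (0<x⇒x≉0 0<x)) (zeroʳ x) (*-monoˡ-≤ x (≰⇒≥ 0<x) x⁻¹≤0)) 1≰0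

  *-cancelˡ-nonneg : ∀ {a x} → 0< a → 0# ≤ a * x → 0# ≤ x
  *-cancelˡ-nonneg {a} {x} 0<a 0≤ax = ≤-respʳ-≈ a⁻¹ax≈x (*-nonneg (⁻¹-nonneg 0<a) 0≤ax)
    where
    a⁻¹ax≈x : a ⁻¹ * (a * x) ≈ x
    a⁻¹ax≈x = begin
      a ⁻¹ * (a * x) ≈⟨ solve 3 (λ b a x → b :* (a :* x) := (a :* b) :* x) refl (a ⁻¹) a x ⟩
      a * a ⁻¹ * x   ≈⟨ *-congʳ (*-inverseʳ (0<x⇒x≉0 0<a)) ⟩
      1# * x         ≈⟨ *-identityˡ x ⟩
      x              ∎

  2½≈1 : 2# * ½ ≈ 1#
  2½≈1 = *-inverseʳ (0<x⇒x≉0 0<2)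

  ⁻¹-unique : ∀ {x y} → ¬ x ≈ 0# → x * y ≈ 1# → y ≈ x ⁻¹
  ⁻¹-unique {x} {y} x≉0 xy≈1 = begin
    y               ≈⟨ *-identityˡ y ⟨
    1# * y          ≈⟨ *-congʳ (*-inverseʳ x≉0) ⟨
    x * x ⁻¹ * y    ≈⟨ solve 3 (λ x z y → x :* z :* y := x :* y :* z) refl x (x ⁻¹) y ⟩
    x * y * x ⁻¹    ≈⟨ *-congʳ xy≈1 ⟩
    1# * x ⁻¹       ≈⟨ *-identityˡ _ ⟩
    x ⁻¹            ∎

  abs : Carrier → Carrier
  abs x with total 0# x
  ... | inj₁ _ = x
  ... | inj₂ _ = - x

  abs-nonneg : ∀ x → 0# ≤ abs x
  abs-nonneg x with total 0# x
  ... | inj₁ 0≤x = 0≤x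
  ... | inj₂ x≤0 = x≤0⇒0≤-x x≤0

  Near : Carrier → Carrier → Carrier → Set
  Near ε x y = x ≤ y + ε × y ≤ x + ε

  -- For `a ≤ 0#` the inequality turns around, and the second half of `Near` is the one multiplied
  -- by `- a`.
  near-*ˡ : ∀ {ε x y} a → Near ε x y → a * x ≤ a * y + ε * abs a
  near-*ˡ {ε} {x} {y} a (x≤y+ε , y≤x+ε) with total 0# a
  ... | inj₁ 0≤a = ≤-respʳ-≈
    (solve 3 (λ a y e → a :* (y :+ e) := a :* y :+ e :* a) refl a y ε)
    (*-monoˡ-≤ a 0≤a x≤y+ε)
  ... | inj₂ a≤0 = ≤-by-gap (*-nonneg (x≤0⇒0≤-x a≤0) (x≤y⇒0≤y-x y≤x+ε))
    (solve 4 (λ a x y e → a :* x :+ (:- a) :* (x :+ e :- y) := a :* y :+ e :* (:- a))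
      refl a x y ε)

  smaller : ∀ {a b} → 0< a → 0< b → ∃ λ c → 0< c × c ≤ a × c ≤ b
  smaller {a} {b} 0<a 0<b with total a b
  ... | inj₁ a≤b = a , 0<a , ≤-refl , a≤b
  ... | inj₂ b≤a = b , 0<b , b≤a , ≤-refl

  -- The supremum of the set of lower bounds; any element of `P` bounds that set from above.
  infimum : (P : Carrier → Set) → ∃ P → (∃ λ l → ∀ x → P x → l ≤ x) → ∃ (IsInfimum P)
  infimum P (x₀ , px₀) lower
    with supremum (λ l → ∀ x → P x → l ≤ x) lower (x₀ , λ l h → h x₀ px₀)
  ... | m , ub , least = m , (λ x px → least x (λ l h → h x px)) , ub

  -- Limits and cluster points under excluded middle.

  module _ (em : ExcludedMiddle 0ℓ) where

    nonneg-limit : ∀ {a k} → 0# ≤ k → (∀ ε → 0< ε → 0# ≤ a + ε * k) → 0# ≤ a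
    nonneg-limit {a} {k} 0≤k bound with em {0# ≤ a}
    ... | yes 0≤a = 0≤a
    ... | no  0≰a = contradiction ε≤0 0<ε
      where
      0<k+1 : 0< k + 1#
      0<k+1 = 1≤x⇒0<x (≤-by-gap 0≤k (+-comm 1# k))

      -- Chosen so that `a + ε * k` equals `- ε`; the summand `1#` keeps the denominator positive
      -- even if `k` vanishes.
      ε = - a * (k + 1#) ⁻¹

      εk+ε≈-a : ε * (k + 1#) ≈ - a
      εk+ε≈-a = begin
        - a * (k + 1#) ⁻¹ * (k + 1#)   ≈⟨ *-assoc _ _ _ ⟩
        - a * ((k + 1#) ⁻¹ * (k + 1#)) ≈⟨ *-congˡ (*-comm _ _) ⟩
        - a * ((k + 1#) * (k + 1#) ⁻¹) ≈⟨ *-congˡ (*-inverseʳ (0<x⇒x≉0 0<k+1)) ⟩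
        - a * 1#                       ≈⟨ *-identityʳ _ ⟩
        - a                            ∎

      0<ε : 0< ε
      0<ε ε≤0 = 0≰a (≤-respʳ-≈ lemma (*-nonneg (≰⇒≥ 0<k+1) (x≤0⇒0≤-x ε≤0)))
        where
        lemma : (k + 1#) * - ε ≈ a
        lemma = begin
          (k + 1#) * - ε   ≈⟨ solve 2 (λ k e → k :* (:- e) := :- (e :* k)) refl (k + 1#) ε ⟩
          - (ε * (k + 1#)) ≈⟨ -‿cong εk+ε≈-a ⟩
          - - a            ≈⟨ -‿involutive a ⟩
          a                ∎

      ε≤0 : ε ≤ 0#
      ε≤0 = 0≤-x⇒x≤0 (≤-respʳ-≈ lemma (bound ε 0<ε))
        where
        lemma : a + ε * k ≈ - ε
        lemma = begin
          a + ε * k                       ≈⟨ +-congʳ (-‿involutive a) ⟨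
          - - a + ε * k                   ≈⟨ +-congʳ (-‿cong εk+ε≈-a) ⟨
          - (ε * (k + 1#)) + ε * k        ≈⟨ solve 2 (λ k e → :- (e :* (k :+ con (+ 1))) :+ e :* k := :- e) refl k ε ⟩
          - ε                             ∎

    -- Take `c = ε ⁻¹` and multiply by `ε`: this gives `0# ≤ b + ε * q` for every positive `ε`.
    nonneg-slope : ∀ {b q} → 0# ≤ q → (∀ c → 0# ≤ c * b + q) → 0# ≤ b
    nonneg-slope {b} {q} 0≤q bounded = nonneg-limit 0≤q λ ε 0<ε → ≤-respʳ-≈ (begin
      ε * (ε ⁻¹ * b + q)
        ≈⟨ solve 4 (λ e d b q → e :* (d :* b :+ q) := e :* d :* b :+ e :* q) refl ε (ε ⁻¹) b q ⟩
      ε * ε ⁻¹ * b + ε * q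
        ≈⟨ +-congʳ (trans (*-congʳ (*-inverseʳ (0<x⇒x≉0 0<ε))) (*-identityˡ b)) ⟩
      b + ε * q ∎)
      (*-nonneg (≰⇒≥ 0<ε) (bounded (ε ⁻¹)))

    ≤-limit : ∀ {x y k} → 0# ≤ k → (∀ ε → 0< ε → x ≤ y + ε * k) → x ≤ y
    ≤-limit {x} {y} {k} 0≤k bound = 0≤y-x⇒x≤y (nonneg-limit 0≤k λ ε 0<ε → ≤-respʳ-≈
      (solve 3 (λ x y d → y :+ d :- x := y :- x :+ d) refl x y (ε * k))
      (x≤y⇒0≤y-x (bound ε 0<ε)))

    -- Otherwise `m + ε` would be a lower bound greater than `m`.
    infimum-approximable : ∀ {P : Carrier → Set} {m ε} → IsInfimum P m → 0< ε →
                           ∃ λ x → P x × x ≤ m + ε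
    infimum-approximable {P} {m} {ε} (_ , greatest) 0<ε with em {∃ λ x → P x × x ≤ m + ε}
    ... | yes x    = x
    ... | no  none = contradiction
      (+-cancelˡ-≤ m (≤-respʳ-≈ (sym (+-identityʳ m))
        (greatest (m + ε) (λ x px → ≰⇒≥ (λ x≤ → none (x , px , x≤))))))
      0<ε

    -- The limit inferior along a decreasing family of nonempty sets is approached
    -- on each of them.
    clusterPoint : {X : Set} (F : Carrier → X → Set) →
      (∀ {ε δ x} → ε ≤ δ → F ε x → F δ x) → (∀ {ε} → 0< ε → ∃ (F ε)) →
      (g : X → Carrier) → (∃₂ λ l u → ∀ x → l ≤ g x × g x ≤ u) →
      ∃ λ c → ∀ {ε} → 0< ε → ∃ λ x → F ε x × Near ε (g x) c
    clusterPoint {X} F mono inhabited g (l , u , bounds) = c , approach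
      where
      EventuallyAbove : Carrier → Set
      EventuallyAbove y = ∃ λ ε → 0< ε × (∀ x → F ε x → y ≤ g x)

      above≤u : ∀ y → EventuallyAbove y → y ≤ u
      above≤u y (ε , 0<ε , h) with x , fx ← inhabited 0<ε =
        ≤-trans (h x fx) (proj₂ (bounds x))

      liminf = supremum EventuallyAbove
        (l , 1# , 1≤x⇒0<x ≤-refl , λ x _ → proj₁ (bounds x)) (u , above≤u)

      c = proj₁ liminf

      near-below : ∀ {ε} → 0< ε → ∃ λ y → EventuallyAbove y × c ≤ y + ε
      near-below {ε} 0<ε with em {∃ λ y → EventuallyAbove y × c ≤ y + ε}
      ... | yes y    = y
      ... | no  none = contradiction
        (0≤-x⇒x≤0 (≤-respʳ-≈ (solve 2 (λ c e → c :- e :- c := :- e) refl c ε)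
          (x≤y⇒0≤y-x (proj₂ (proj₂ liminf) (c - ε) below))))
        0<ε
        where
        below : ∀ y → EventuallyAbove y → y ≤ c - ε
        below y above = ≤-resp-≈
          (solve 2 (λ y e → y :+ e :- e := y) refl y ε) refl
          (+-monoˡ-≤ (- ε) (≰⇒≥ (λ c≤ → none (y , above , c≤))))

      approach : ∀ {ε} → 0< ε → ∃ λ x → F ε x × Near ε (g x) c
      approach {ε} 0<ε
        with y , (δ , 0<δ , y-below) , c≤y+ε ← near-below 0<ε
        -- `η ≤ δ` provides the lower bound `y` on `F η`, while `η ≤ ε` provides membership in
        -- `F ε`.
        with η , 0<η , η≤ε , η≤δ ← smaller 0<ε 0<δ
        with em {∃ λ x → F η x × g x ≤ c + ε}
      ... | yes (x , fx , gx≤) =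
        x , mono η≤ε fx , gx≤ , ≤-trans c≤y+ε (+-monoˡ-≤ ε (y-below x (mono η≤δ fx)))
      -- Here `c + ε` would bound `g` from below on `F η`, so it would be one of the values of which
      -- `c` is the supremum.
      ... | no none = contradiction
        (+-cancelˡ-≤ c (≤-respʳ-≈ (sym (+-identityʳ c))
          (proj₁ (proj₂ liminf) (c + ε) (η , 0<η , λ x fx → ≰⇒≥ (λ gx≤ → none (x , fx , gx≤))))))
        0<ε

    -- In place of successive subsequences, closeness to the first cluster value becomes part of the
    -- family (`F′`), so that a point found for the later coordinates also serves the first.
    clusterPoints : ∀ {X : Set} n (F : Carrier → X → Set) →
      (∀ {ε δ x} → ε ≤ δ → F ε x → F δ x) → (∀ {ε} → 0< ε → ∃ (F ε)) →
      (g : Fin n → X → Carrier) → (∀ i → ∃₂ λ l u → ∀ x → l ≤ g i x × g i x ≤ u) →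
      ∃ λ (c : Fin n → Carrier) → ∀ {ε} → 0< ε → ∃ λ x → F ε x × (∀ i → Near ε (g i x) (c i))
    clusterPoints zero F mono inhabited g bounds =
      (λ ()) , λ 0<ε → proj₁ (inhabited 0<ε) , proj₂ (inhabited 0<ε) , λ ()
    clusterPoints {X} (suc n) F mono inhabited g bounds = c , approach
      where
      first = clusterPoint F mono inhabited (g zero) (bounds zero)

      F′ : Carrier → X → Set
      F′ ε x = F ε x × Near ε (g zero x) (proj₁ first)

      rest = clusterPoints n F′
        (λ ε≤δ (fx , p , q) → mono ε≤δ fx ,
          ≤-trans p (+-monoʳ-≤ _ ε≤δ) , ≤-trans q (+-monoʳ-≤ _ ε≤δ))
        (proj₂ first) (λ i → g (suc i)) (λ i → bounds (suc i))

      c : Fin (suc n) → Carrier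
      c zero    = proj₁ first
      c (suc i) = proj₁ rest i

      approach : ∀ {ε} → 0< ε → ∃ λ x → F ε x × (∀ i → Near ε (g i x) (c i))
      approach 0<ε with x , (fx , near₀) , near ← proj₂ rest 0<ε =
        x , fx , λ { zero → near₀ ; (suc i) → near i }

-- Bilinear forms given by matrices.

module QuadraticForms (ℝ : CompleteOrderedField) where
  open CompleteOrderedField ℝ hiding (zero)
  open OrderedField ℝ
  open IntegerCoefficients commutativeRing
  open SemiringSum semiring using (sum; sum-cong-≋; ∑-distrib-+; ∑-comm; *-distribˡ-sum)
  open SetoidReasoning setoid

  form : ∀ {n} → (Fin n → Fin n → Carrier) → (x y : Fin n → Carrier) → Carrier
  form M x y = sum λ i → sum λ j → x i * M i j * y j

  form-cong : ∀ {n} {M N : Fin n → Fin n → Carrier} {x x′ y y′} →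
              (∀ i j → M i j ≈ N i j) → (∀ i → x i ≈ x′ i) → (∀ i → y i ≈ y′ i) →
              form M x y ≈ form N x′ y′
  form-cong M≈N x≈x′ y≈y′ = sum-cong-≋ λ i → sum-cong-≋ λ j →
    *-cong (*-cong (x≈x′ i) (M≈N i j)) (y≈y′ j)

  form-+ˡ : ∀ {n} (M : Fin n → Fin n → Carrier) x x′ y →
            form M (λ i → x i + x′ i) y ≈ form M x y + form M x′ y
  form-+ˡ M x x′ y = begin
    form M (λ i → x i + x′ i) y
      ≈⟨ sum-cong-≋ (λ i → trans
           (sum-cong-≋ λ j → solve 4 (λ a b m c → (a :+ b) :* m :* c := a :* m :* c :+ b :* m :* c)
             refl (x i) (x′ i) (M i j) (y j))
           (∑-distrib-+ (λ j → x i * M i j * y j) (λ j → x′ i * M i j * y j))) ⟩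
    sum (λ i → sum (λ j → x i * M i j * y j) + sum (λ j → x′ i * M i j * y j))
      ≈⟨ ∑-distrib-+ (λ i → sum λ j → x i * M i j * y j) (λ i → sum λ j → x′ i * M i j * y j) ⟩
    form M x y + form M x′ y ∎

  form-+ᴹ : ∀ {n} (M N : Fin n → Fin n → Carrier) x y →
            form (λ i j → M i j + N i j) x y ≈ form M x y + form N x y
  form-+ᴹ M N x y = begin
    form (λ i j → M i j + N i j) x y
      ≈⟨ sum-cong-≋ (λ i → trans
           (sum-cong-≋ λ j → solve 4 (λ a m n c → a :* (m :+ n) :* c := a :* m :* c :+ a :* n :* c)
             refl (x i) (M i j) (N i j) (y j))
           (∑-distrib-+ (λ j → x i * M i j * y j) (λ j → x i * N i j * y j))) ⟩
    sum (λ i → sum (λ j → x i * M i j * y j) + sum (λ j → x i * N i j * y j))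
      ≈⟨ ∑-distrib-+ (λ i → sum λ j → x i * M i j * y j) (λ i → sum λ j → x i * N i j * y j) ⟩
    form M x y + form N x y ∎

  scale-sum : ∀ {n} a (f g : Fin n → Carrier) → (∀ i → g i ≈ a * f i) → sum g ≈ a * sum f
  scale-sum a f g g≈af = trans (sum-cong-≋ g≈af) (sym (*-distribˡ-sum a f))

  form-*ˡ : ∀ {n} (M : Fin n → Fin n → Carrier) a x y →
            form M (λ i → a * x i) y ≈ a * form M x y
  form-*ˡ M a x y = scale-sum a _ _ λ i → scale-sum a _ _ λ j →
    solve 4 (λ a b m c → a :* b :* m :* c := a :* (b :* m :* c)) refl a (x i) (M i j) (y j)

  form-*ᴹ : ∀ {n} (M : Fin n → Fin n → Carrier) a x y →
            form (λ i j → a * M i j) x y ≈ a * form M x y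
  form-*ᴹ M a x y = scale-sum a _ _ λ i → scale-sum a _ _ λ j →
    solve 4 (λ a b m c → b :* (a :* m) :* c := a :* (b :* m :* c)) refl a (x i) (M i j) (y j)

  form-sym : ∀ {n} {M : Fin n → Fin n → Carrier} → (∀ i j → M i j ≈ M j i) →
             ∀ x y → form M x y ≈ form M y x
  form-sym {M = M} M-sym x y = trans (∑-comm λ i j → x i * M i j * y j)
    (sum-cong-≋ λ j → sum-cong-≋ λ i → trans (*-congʳ (*-congˡ (M-sym i j)))
      (solve 3 (λ a m c → a :* m :* c := c :* m :* a) refl (x i) (M j i) (y j)))

  -- The Kronecker delta; partially applied, `δ i` is a standard basis vector. Structural recursion
  -- lets sums against it be evaluated by induction.
  δ : ∀ {n} → Fin n → Fin n → Carrier
  δ zero    zero    = 1#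
  δ zero    (suc j) = 0#
  δ (suc i) zero    = 0#
  δ (suc i) (suc j) = δ i j

  δ-refl : ∀ {n} (i : Fin n) → δ i i ≈ 1#
  δ-refl zero    = refl
  δ-refl (suc i) = δ-refl i

  δ-sym : ∀ {n} (i j : Fin n) → δ i j ≈ δ j i
  δ-sym zero    zero    = refl
  δ-sym zero    (suc j) = refl
  δ-sym (suc i) zero    = refl
  δ-sym (suc i) (suc j) = δ-sym i j

  δ-off : ∀ {n} {i j : Fin n} → ¬ i ≡ j → δ i j ≈ 0#
  δ-off {i = zero}  {zero}  i≢j = contradiction ≡.refl i≢j
  δ-off {i = zero}  {suc j} i≢j = refl
  δ-off {i = suc i} {zero}  i≢j = refl
  δ-off {i = suc i} {suc j} i≢j = δ-off (λ i≡j → i≢j (≡.cong suc i≡j))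

  sum-0 : ∀ {n} (f : Fin n → Carrier) → (∀ i → f i ≈ 0#) → sum f ≈ 0#
  sum-0 {zero}  f f≈0 = refl
  sum-0 {suc n} f f≈0 = trans (+-cong (f≈0 zero) (sum-0 (λ i → f (suc i)) (λ i → f≈0 (suc i))))
                              (+-identityˡ 0#)

  sum-δ : ∀ {n} (u : Fin n) f → sum (λ i → δ u i * f i) ≈ f u
  sum-δ zero f = trans
    (+-cong (*-identityˡ (f zero)) (sum-0 (λ i → 0# * f (suc i)) (λ i → zeroˡ (f (suc i)))))
    (+-identityʳ (f zero))
  sum-δ (suc u) f = trans (+-cong (zeroˡ (f zero)) (sum-δ u (λ i → f (suc i)))) (+-identityˡ _)

  form-δ : ∀ {n} (M : Fin n → Fin n → Carrier) u v → form M (δ u) (δ v) ≈ M u v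
  form-δ M u v = begin
    form M (δ u) (δ v)
      ≈⟨ sum-cong-≋ (λ i → trans
           (scale-sum (δ u i) (λ j → δ v j * M i j) (λ j → δ u i * M i j * δ v j) λ j →
             solve 3 (λ a m b → a :* m :* b := a :* (b :* m)) refl (δ u i) (M i j) (δ v j))
           (*-congˡ (sum-δ v (M i)))) ⟩
    sum (λ i → δ u i * M i v)
      ≈⟨ sum-δ u (λ i → M i v) ⟩
    M u v ∎

  -- The factor `e` stays outside the sum, so the bound can be nested for double sums and ends in
  -- the shape that `nonneg-limit` takes.
  sum-≤ : ∀ {n} e {f g k : Fin n → Carrier} → (∀ i → f i ≤ g i + e * k i) →
          sum f ≤ sum g + e * sum k
  sum-≤ {zero} e f≤ = ≤-reflexive (solve 1 (λ e → con (+ 0) := con (+ 0) :+ e :* con (+ 0)) refl e)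
  sum-≤ {suc n} e {f} {g} {k} f≤ = ≤-respʳ-≈
    (solve 5 (λ e a b c d → a :+ e :* b :+ (c :+ e :* d) := a :+ c :+ e :* (b :+ d))
      refl e (g zero) (k zero) (sum λ i → g (suc i)) (sum λ i → k (suc i)))
    (+-mono-≤ (f≤ zero) (sum-≤ e (λ i → f≤ (suc i))))

  sum-nonneg : ∀ {n} (f : Fin n → Carrier) → (∀ i → 0# ≤ f i) → 0# ≤ sum f
  sum-nonneg {zero}  f 0≤f = ≤-refl
  sum-nonneg {suc n} f 0≤f = +-nonneg (0≤f zero) (sum-nonneg (λ i → f (suc i)) (λ i → 0≤f (suc i)))

  Fin-finite : ∀ n → Finite (Fin n)
  Fin-finite n = record { size = n ; enum = ↔-id (Fin n) }

  PSD : ∀ {n} → (Fin n → Fin n → Carrier) → Set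
  PSD {n} = PositiveSemidefinite ℝ (Fin-finite n)

  -- Transfer between matrices over a finite type and matrices over `Fin`.

  module _ {V : Set} (finite : Finite V) where
    open Finite finite

    index : V → Fin size
    index = Inverse.from enum

    element-index : ∀ v → element (index v) ≡ v
    element-index = Inverse.strictlyInverseˡ enum

    index-element : ∀ i → index (element i) ≡ i
    index-element = Inverse.strictlyInverseʳ enum

    onIndices : {A : Set} → (V → V → A) → Fin size → Fin size → A
    onIndices M i j = M (element i) (element j)

    PSD-onIndices : ∀ {M} → PositiveSemidefinite ℝ finite M → PSD (onIndices M)
    PSD-onIndices {M} psd = record
      { symmetric = λ i j → symmetric (element i) (element j)
      ; nonneg    = λ x → ≤-respʳ-≈
          (form-cong (λ _ _ → refl) (λ i → reflexive (≡.cong x (index-element i)))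
                                    (λ i → reflexive (≡.cong x (index-element i))))
          (nonneg (λ v → x (index v)))
      }
      where open PositiveSemidefinite psd

    PSD-fromIndices : ∀ {M} → PSD M → PositiveSemidefinite ℝ finite (λ u v → M (index u) (index v))
    PSD-fromIndices {M} psd = record
      { symmetric = λ u v → symmetric (index u) (index v)
      ; nonneg    = λ x → ≤-respʳ-≈
          (form-cong (λ i j → reflexive (≡.cong₂ M (≡.sym (index-element i)) (≡.sym (index-element j))))
                     (λ _ → refl) (λ _ → refl))
          (nonneg (λ i → x (element i)))
      }
      where open PositiveSemidefinite psd

  -- Positive semidefinite matrices and the inner product spaces they define.

  module _ {n} {M : Fin n → Fin n → Carrier} (psd : PSD M) where
    open PositiveSemidefinite psd

    private
      form-symᴹ = form-sym symmetric

    -- The expansion of the form at `c x + z`, with the cross terms merged by symmetry. It serves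
    -- the entry bound with `c = ±1` and the study of null vectors with arbitrary `c`.
    form-line : ∀ c x z → let y = λ i → c * x i + z i in
                form M y y ≈ c * (c * form M x x) + c * (form M x z + form M x z) + form M z z
    form-line c x z = begin
      form M y y
        ≈⟨ split y ⟩
      c * form M x y + form M z y
        ≈⟨ +-cong (*-congˡ (trans (form-symᴹ x y) (split x))) (trans (form-symᴹ z y) (split z)) ⟩
      c * (c * form M x x + form M z x) + (c * form M x z + form M z z)
        ≈⟨ +-congʳ (*-congˡ (+-congˡ (form-symᴹ z x))) ⟩
      c * (c * form M x x + form M x z) + (c * form M x z + form M z z)
        ≈⟨ solve 4 (λ c a b d → c :* (c :* a :+ b) :+ (c :* b :+ d) := c :* (c :* a) :+ c :* (b :+ b) :+ d)
             refl c (form M x x) (form M x z) (form M z z) ⟩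
      c * (c * form M x x) + c * (form M x z + form M x z) + form M z z ∎
      where
      y : Fin n → Carrier
      y i = c * x i + z i
      split : ∀ w → form M y w ≈ c * form M x w + form M z w
      split w = trans (form-+ˡ M (λ i → c * x i) z w) (+-congʳ (form-*ˡ M c x w))

    -- The form at `c δ u + δ v` with `c = ±1` has the value `2# * (l + c * m)`, which is
    -- nonnegative.
    PSD-entry : ∀ {l} → (∀ i → M i i ≈ l) → ∀ u v → - l ≤ M u v × M u v ≤ l
    PSD-entry {l} diagonal u v = ≤-by-gap (half 1# (*-identityˡ 1#)) lower , ≤-by-gap (half (- 1#) -1*-1≈1) upper
      where
      m = M u v

      -1*-1≈1 : - 1# * - 1# ≈ 1#
      -1*-1≈1 = solve 0 ((:- con (+ 1)) :* (:- con (+ 1)) := con (+ 1)) refl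

      half : ∀ c → c * c ≈ 1# → 0# ≤ l + c * m
      half c cc≈1 = *-cancelˡ-nonneg 0<2 (≤-respʳ-≈ eq (nonneg (λ i → c * δ u i + δ v i)))
        where
        eq : form M (λ i → c * δ u i + δ v i) (λ i → c * δ u i + δ v i) ≈ 2# * (l + c * m)
        eq = begin
          _ ≈⟨ form-line c (δ u) (δ v) ⟩
          _ ≈⟨ +-cong (+-cong (*-congˡ (*-congˡ (trans (form-δ M u u) (diagonal u))))
                              (*-congˡ (+-cong (form-δ M u v) (form-δ M u v))))
                      (trans (form-δ M v v) (diagonal v)) ⟩
          c * (c * l) + c * (m + m) + l
            ≈⟨ solve 3 (λ c l m → c :* (c :* l) :+ c :* (m :+ m) :+ l
                               := c :* c :* l :+ (c :* (m :+ m) :+ l)) refl c l m ⟩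
          c * c * l + (c * (m + m) + l) ≈⟨ +-congʳ (*-congʳ cc≈1) ⟩
          1# * l + (c * (m + m) + l)
            ≈⟨ solve 3 (λ c l m → con (+ 1) :* l :+ (c :* (m :+ m) :+ l)
                               := (con (+ 1) :+ con (+ 1)) :* (l :+ c :* m)) refl c l m ⟩
          2# * (l + c * m) ∎

      lower : - l + (l + 1# * m) ≈ m
      lower = solve 2 (λ l m → :- l :+ (l :+ con (+ 1) :* m) := m) refl l m

      upper : m + (l + - 1# * m) ≈ l
      upper = solve 2 (λ l m → m :+ (l :+ (:- con (+ 1)) :* m) := l) refl l m

    module _ (em : ExcludedMiddle 0ℓ) where

      -- Along the line c x + z the form is an affine function of c which is bounded below.
      form-null : ∀ x → form M x x ≈ 0# → ∀ z → form M x z ≈ 0#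
      form-null x q≈0 z = antisym
        (0≤-x⇒x≤0 (*-cancelˡ-nonneg 0<2 (nonneg-slope em (nonneg z) λ c → ≤-respʳ-≈
          (solve 3 (λ c b q → (:- c) :* (b :+ b) :+ q := c :* ((con (+ 1) :+ con (+ 1)) :* (:- b)) :+ q)
            refl c b q)
          (bounded (- c)))))
        (*-cancelˡ-nonneg 0<2 (nonneg-slope em (nonneg z) λ c → ≤-respʳ-≈
          (solve 3 (λ c b q → c :* (b :+ b) :+ q := c :* ((con (+ 1) :+ con (+ 1)) :* b) :+ q)
            refl c b q)
          (bounded c)))
        where
        b = form M x z
        q = form M z z

        bounded : ∀ c → 0# ≤ c * (b + b) + q
        bounded c = ≤-respʳ-≈ (begin
          _
            ≈⟨ form-line c x z ⟩
          c * (c * form M x x) + c * (b + b) + q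
            ≈⟨ +-congʳ (trans (+-congʳ (trans (*-congˡ (trans (*-congˡ q≈0) (zeroʳ c))) (zeroʳ c)))
                              (+-identityˡ _)) ⟩
          c * (b + b) + q ∎)
          (nonneg (λ i → c * x i + z i))

      -- The null vectors are divided out by the choice of the setoid equality.
      gramSpace : InnerProductSpace ℝ
      gramSpace = record
        { vectorSpace = record
          { Carrierᴹ = Fin n → Carrier
          ; _≈ᴹ_     = _≈ᴹ_
          ; _+ᴹ_     = λ x y i → x i + y i
          ; _*ₗ_     = λ a x i → a * x i
          ; 0ᴹ       = λ _ → 0#
          ; -ᴹ_      = λ x i → - x i
          ; isLeftModule = record
            { isLeftSemimodule = record
              { +ᴹ-isCommutativeMonoid = record
                { isMonoid = record
                  { isSemigroup = record
                    { isMagma = record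
                      { isEquivalence = record
                        { refl  = λ z → refl
                        ; sym   = λ x≈y z → sym (x≈y z)
                        ; trans = λ x≈y y≈w z → trans (x≈y z) (y≈w z)
                        }
                      ; ∙-cong = +ᴹ-cong
                      }
                    ; assoc = λ x y w → pointwise λ i → +-assoc (x i) (y i) (w i)
                    }
                  ; identity = (λ x → pointwise λ i → +-identityˡ (x i))
                             , (λ x → pointwise λ i → +-identityʳ (x i))
                  }
                ; comm = λ x y → pointwise λ i → +-comm (x i) (y i)
                }
              ; isPreleftSemimodule = record
                { *ₗ-cong      = *ₗ-cong
                ; *ₗ-zeroˡ     = λ x → pointwise λ i → zeroˡ (x i)
                ; *ₗ-distribʳ  = λ x a b → pointwise λ i → distribʳ (x i) a b
                ; *ₗ-identityˡ = λ x → pointwise λ i → *-identityˡ (x i)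
                ; *ₗ-assoc     = λ a b x → pointwise λ i → *-assoc a b (x i)
                ; *ₗ-zeroʳ     = λ a → pointwise λ i → zeroʳ a
                ; *ₗ-distribˡ  = λ a x y → pointwise λ i → distribˡ a (x i) (y i)
                }
              }
            ; -ᴹ‿cong = λ {x} {y} x≈y → pointwise-trans (λ i → negate (x i))
                (*ₗ-cong {u = - 1#} {v = - 1#} {x = x} {y = y} refl x≈y) (λ i → sym (negate (y i)))
            ; -ᴹ‿inverse = (λ x → pointwise λ i → -‿inverseˡ (x i))
                         , (λ x → pointwise λ i → -‿inverseʳ (x i))
            }
          }
        ; ⟨_,_⟩    = form M
        ; ⟨⟩-cong  = λ {x} {x′} {y} {y′} x≈x′ y≈y′ →
            trans (x≈x′ y) (trans (form-symᴹ x′ y) (trans (y≈y′ x′) (form-symᴹ y′ x′)))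
        ; ⟨⟩-sym   = form-symᴹ
        ; ⟨⟩-+     = form-+ˡ M
        ; ⟨⟩-*     = form-*ˡ M
        ; nonneg   = nonneg
        ; definite = λ x q≈0 z → trans (form-null x q≈0 z) (sym (form-0ˡ z))
        ; spanSize = n
        ; spanning = δ
        ; coefficients = λ x → x , pointwise λ i → sym (expansion x i)
        }
        where
        infix 4 _≈ᴹ_

        -- Equality modulo the radical: in this form all congruences follow from bilinearity and
        -- symmetry, and only `definite` calls on `form-null`.
        _≈ᴹ_ : (x y : Fin n → Carrier) → Set
        x ≈ᴹ y = ∀ z → form M x z ≈ form M y z

        pointwise : ∀ {x y} → (∀ i → x i ≈ y i) → x ≈ᴹ y
        pointwise x≈y z = form-cong (λ _ _ → refl) x≈y (λ _ → refl)

        pointwise-trans : ∀ {x x′ y y′} → (∀ i → x i ≈ x′ i) → x′ ≈ᴹ y′ → (∀ i → y′ i ≈ y i) → x ≈ᴹ y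
        pointwise-trans x≈x′ x′≈y′ y′≈y z =
          trans (pointwise x≈x′ z) (trans (x′≈y′ z) (pointwise y′≈y z))

        +ᴹ-cong : ∀ {x x′ y y′} → x ≈ᴹ x′ → y ≈ᴹ y′ → (λ i → x i + y i) ≈ᴹ (λ i → x′ i + y′ i)
        +ᴹ-cong {x} {x′} {y} {y′} x≈x′ y≈y′ z = trans (form-+ˡ M x y z)
          (trans (+-cong (x≈x′ z) (y≈y′ z)) (sym (form-+ˡ M x′ y′ z)))

        *ₗ-cong : ∀ {u v x y} → u ≈ v → x ≈ᴹ y → (λ i → u * x i) ≈ᴹ (λ i → v * y i)
        *ₗ-cong {u} {v} {x} {y} u≈v x≈y z = trans (form-*ˡ M u x z)
          (trans (*-cong u≈v (x≈y z)) (sym (form-*ˡ M v y z)))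

        negate : ∀ a → - a ≈ - 1# * a
        negate = solve 1 (λ a → :- a := (:- con (+ 1)) :* a) refl

        form-0ˡ : ∀ z → form M (λ _ → 0#) z ≈ 0#
        form-0ˡ z = sum-0 _ λ i → sum-0 _ λ j →
          trans (*-congʳ (zeroˡ (M i j))) (zeroˡ (z j))

        -- This is what the sum in the type of `coefficients` computes to for the space under
        -- construction.
        sumᴹ : ∀ {m} → (Fin m → Fin n → Carrier) → Fin n → Carrier
        sumᴹ = foldr (λ x y i → x i + y i) (λ _ → 0#)

        sumᴹ-apply : ∀ {m} (f : Fin m → Fin n → Carrier) i → sumᴹ f i ≈ sum (λ j → f j i)
        sumᴹ-apply {zero}  f i = refl
        sumᴹ-apply {suc m} f i = +-congˡ (sumᴹ-apply (λ j → f (suc j)) i)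

        expansion : ∀ x i → sumᴹ (λ j k → x j * δ j k) i ≈ x i
        expansion x i = begin
          sumᴹ (λ j k → x j * δ j k) i ≈⟨ sumᴹ-apply (λ j k → x j * δ j k) i ⟩
          sum (λ j → x j * δ j i)      ≈⟨ sum-cong-≋ (λ j → trans (*-comm _ _) (*-congʳ (δ-sym j i))) ⟩
          sum (λ j → δ i j * x j)      ≈⟨ sum-δ i x ⟩
          x i                          ∎

-- Attainment of the minimum in the theta program.

module ThetaAttained (em : ExcludedMiddle 0ℓ) (ℝ : CompleteOrderedField)
                     (H : SimpleGraph) (finite : Finite (SimpleGraph.V H))
                     (v₀ : SimpleGraph.V H) where
  open CompleteOrderedField ℝ hiding (zero)
  open OrderedField ℝ
  open QuadraticForms ℝ
  open IntegerCoefficients commutativeRing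
  open SemiringSum semiring using (sum; sum-cong-≋; *-distribʳ-sum; *-distribˡ-sum)
  open SetoidReasoning setoid
  open SimpleGraph H hiding (symmetric)
  open Finite finite

  Feasible : Carrier → Set
  Feasible = ThetaFeasible ℝ H finite

  power : ℕ → Carrier
  power zero    = 1#
  power (suc n) = 2# * power n

  power≥1 : ∀ n → 1# ≤ power n
  power≥1 zero    = ≤-refl
  power≥1 (suc n) = ≤-trans 1≤2
    (≤-respˡ-≈ (*-identityʳ 2#) (*-monoˡ-≤ 2# 0≤2 (power≥1 n)))

  -- Cauchy–Schwarz would give n in place of 2ⁿ.
  square-sum-≤ : ∀ n (x : Fin n → Carrier) →
                 sum x * sum x ≤ power n * sum (λ i → x i * x i)
  square-sum-≤ zero    x = ≤-reflexive (solve 0 (con (+ 0) :* con (+ 0) := con (+ 1) :* con (+ 0)) refl)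
  -- The gap adds up the slacks of `(a + s)² ≤ 2 (a² + s²)`, of `1# ≤ p` and of the induction
  -- hypothesis `s² ≤ p q`.
  square-sum-≤ (suc n) x = ≤-by-gap
    (+-nonneg (square-nonneg (a - s))
      (*-nonneg 0≤2 (+-nonneg
        (*-nonneg (x≤y⇒0≤y-x (power≥1 n)) (square-nonneg a))
        (x≤y⇒0≤y-x (square-sum-≤ n (λ i → x (suc i)))))))
    (solve 4 (λ a s p q → (a :+ s) :* (a :+ s) :+ ((a :- s) :* (a :- s) :+
                (con (+ 1) :+ con (+ 1)) :* ((p :- con (+ 1)) :* (a :* a) :+ (p :* q :- s :* s)))
              := (con (+ 1) :+ con (+ 1)) :* p :* (a :* a :+ q))
      refl a s (power n) q)
    where
    a = x zero
    s = sum λ i → x (suc i)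
    q = sum λ i → x (suc i) * x (suc i)

  N : Carrier
  N = power size

  -- With `J` the all-ones matrix, the form is `N ∑ x² - (∑ x)²`, nonnegative by `square-sum-≤`. As
  -- every off-diagonal entry is `- 1#`, the matrix is feasible for any graph on these vertices.
  PSD-N·I-J : PSD {size} (λ i j → N * δ i j + - 1#)
  PSD-N·I-J = record
    { symmetric = λ i j → +-congʳ (*-congˡ (δ-sym i j))
    ; nonneg    = λ x → ≤-respʳ-≈ (sym (value x)) (x≤y⇒0≤y-x (square-sum-≤ size x))
    }
    where
    form-I : ∀ {n} (x y : Fin n → Carrier) → form δ x y ≈ sum (λ i → x i * y i)
    form-I x y = sum-cong-≋ λ i → trans
      (scale-sum (x i) _ _ λ j → *-assoc (x i) (δ i j) (y j))
      (*-congˡ (sum-δ i y))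

    form-const : ∀ {n} a (x y : Fin n → Carrier) → form (λ _ _ → a) x y ≈ a * (sum x * sum y)
    form-const a x y = trans
      (scale-sum a (λ i → x i * sum y) _ λ i → trans
        (sym (*-distribˡ-sum (x i * a) y))
        (solve 3 (λ x a s → x :* a :* s := a :* (x :* s)) refl (x i) a (sum y)))
      (*-congˡ (sym (*-distribʳ-sum (sum y) x)))

    value : ∀ x → form (λ i j → N * δ i j + - 1#) x x ≈ N * sum (λ i → x i * x i) - sum x * sum x
    value x = begin
      form (λ i j → N * δ i j + - 1#) x x
        ≈⟨ form-+ᴹ (λ i j → N * δ i j) (λ _ _ → - 1#) x x ⟩
      form (λ i j → N * δ i j) x x + form (λ _ _ → - 1#) x x
        ≈⟨ +-cong (trans (form-*ᴹ δ N x x) (*-congˡ (form-I x x))) (form-const (- 1#) x x) ⟩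
      N * sum (λ i → x i * x i) + - 1# * (sum x * sum x)
        ≈⟨ solve 2 (λ a b → a :+ (:- con (+ 1)) :* b := a :- b) refl _ _ ⟩
      N * sum (λ i → x i * x i) - sum x * sum x ∎

  feasible-N : Feasible N
  feasible-N = (λ u v → N * δ (index finite u) (index finite v) + - 1#)
    , PSD-fromIndices finite PSD-N·I-J
    , (λ v → +-congʳ (trans (*-congˡ (δ-refl (index finite v))) (*-identityʳ N)))
    , λ {u} {v} u~v → trans (+-congʳ (trans (*-congˡ (δ-off (distinct u~v))) (zeroʳ N))) (+-identityˡ _)
    where
    distinct : ∀ {u v} → Adj u v → ¬ index finite u ≡ index finite v
    distinct {u} {v} u~v iu≡iv = loopless (≡.subst (Adj u) v≡u u~v)
      where
      v≡u : v ≡ u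
      v≡u = ≡.trans (≡.sym (element-index finite v))
        (≡.trans (≡.cong element (≡.sym iu≡iv)) (element-index finite u))

  module _ {l} (feasible : Feasible l) where
    private
      M = proj₁ feasible

    feasible-entry : ∀ u v → - (l - 1#) ≤ M u v × M u v ≤ l - 1#
    feasible-entry u v = ≡.subst₂ (λ u v → - (l - 1#) ≤ M u v × M u v ≤ l - 1#)
      (element-index finite u) (element-index finite v)
      (PSD-entry (PSD-onIndices finite (proj₁ (proj₂ feasible)))
        (λ i → proj₁ (proj₂ (proj₂ feasible)) (element i)) (index finite u) (index finite v))

    -- The entry at `v₀` lies between `- (l - 1#)` and `l - 1#`, hence `l - 1#` is nonnegative.
    1≤feasible : 1# ≤ l
    1≤feasible = 0≤y-x⇒x≤y (*-cancelˡ-nonneg 0<2 (≤-respʳ-≈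
      (solve 1 (λ d → d :- (:- d) := (con (+ 1) :+ con (+ 1)) :* d) refl (l - 1#))
      (x≤y⇒0≤y-x (≤-trans (proj₁ (feasible-entry v₀ v₀)) (proj₂ (feasible-entry v₀ v₀))))))

  module _ {bound θ} (feasible-bound : Feasible bound) (isInfimum : IsInfimum Feasible θ) where
    -- The cap `l ≤ bound` makes the matrix entries uniformly bounded, as the existence of cluster
    -- points demands.
    Point : Set
    Point = ∃ λ l → Feasible l × l ≤ bound

    matrix : Point → V → V → Carrier
    matrix (_ , (M , _) , _) = M

    NearOptimal : Carrier → Point → Set
    NearOptimal ε (l , _) = l ≤ θ + ε

    nearOptimal : ∀ {ε} → 0< ε → ∃ (NearOptimal ε)
    nearOptimal 0<ε with l , fl , l≤θ+ε ← infimum-approximable em isInfimum 0<ε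
      with total l bound
    ... | inj₁ l≤b = (l , fl , l≤b) , l≤θ+ε
    -- An approximant beyond the cap shows that `bound` is itself near-optimal.
    ... | inj₂ b≤l = (bound , feasible-bound , ≤-refl) , ≤-trans b≤l l≤θ+ε

    -- Matrices are flattened into finitely many real coordinates, to which `clusterPoints` applies.
    coordinate : Fin (size ℕ.* size) → Point → Carrier
    coordinate k p = matrix p (element (proj₁ (remQuot {size} size k))) (element (proj₂ (remQuot {size} size k)))

    coordinate-bounds : ∀ k → ∃₂ λ l u → ∀ p → l ≤ coordinate k p × coordinate k p ≤ u
    coordinate-bounds k = - (bound - 1#) , bound - 1# , bounds
      where
      bounds : ∀ p → - (bound - 1#) ≤ coordinate k p × coordinate k p ≤ bound - 1#
      bounds (l , fl , l≤b) =
        ≤-trans (≤-by-gap (x≤y⇒0≤y-x l≤b)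
          (solve 2 (λ n l → :- (n :- con (+ 1)) :+ (n :- l) := :- (l :- con (+ 1))) refl bound l))
          (proj₁ (feasible-entry fl _ _)) ,
        ≤-trans (proj₂ (feasible-entry fl _ _)) (+-monoˡ-≤ (- 1#) l≤b)

    opaque
      cluster : ∃ λ (c : Fin (size ℕ.* size) → Carrier) → ∀ {ε} → 0< ε →
                ∃ λ p → NearOptimal ε p × (∀ k → Near ε (coordinate k p) (c k))
      cluster = clusterPoints em (size ℕ.* size) NearOptimal (λ ε≤δ l≤ → ≤-trans l≤ (+-monoʳ-≤ θ ε≤δ))
                  nearOptimal coordinate coordinate-bounds

    -- The limit matrix, reassembled from its coordinates.
    C : V → V → Carrier
    C u v = proj₁ cluster (combine (index finite u) (index finite v))

    Approximation : Carrier → Set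
    Approximation ε = ∃ λ p → NearOptimal ε p × (∀ u v → Near ε (matrix p u v) (C u v))

    approximations : ∀ {ε} → 0< ε → Approximation ε
    approximations {ε} 0<ε = p , opt , λ u v →
      ≡.subst₂ (λ u′ v′ → Near ε (matrix p u′ v′) (C u v))
        (decode proj₁ u v (element-index finite u)) (decode proj₂ u v (element-index finite v))
        (near (combine (index finite u) (index finite v)))
      where
      approximation = proj₂ cluster 0<ε
      p    = proj₁ approximation
      opt  = proj₁ (proj₂ approximation)
      near = proj₂ (proj₂ approximation)

      decode : (f : Fin size × Fin size → Fin size) → ∀ u v {w} → element (f (index finite u , index finite v)) ≡ w →
               element (f (remQuot {size} size (combine (index finite u) (index finite v)))) ≡ w
      decode f u v = ≡.trans (≡.cong (λ q → element (f q)) (remQuot-combine (index finite u) (index finite v)))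

    C-psd : PositiveSemidefinite ℝ finite C
    C-psd = record { symmetric = λ u v → antisym (C-sym u v) (C-sym v u) ; nonneg = C-nonneg }
      where
      open PositiveSemidefinite

      C-sym : ∀ u v → C u v ≤ C v u
      -- One `ε` is spent on each of the two entries.
      C-sym u v = ≤-limit em 0≤2 λ ε 0<ε → estimate (approximations 0<ε)
        where
        estimate : ∀ {ε} → Approximation ε →
                C u v ≤ C v u + ε * 2#
        estimate {ε} ((_ , (_ , psd , _) , _) , _ , near) = ≤-trans (proj₂ (near u v))
          (≤-resp-≈ (+-congʳ (symmetric psd v u))
            (solve 2 (λ c e → c :+ e :+ e := c :+ e :* (con (+ 1) :+ con (+ 1))) refl (C v u) ε)
            (+-monoˡ-≤ ε (proj₁ (near v u))))

      C-nonneg : ∀ x → 0# ≤ ∑ ℝ finite (λ u → ∑ ℝ finite λ v → x u * C u v * x v)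
      C-nonneg x = nonneg-limit em
        -- The error is `ε` times the total weight `∑ |x u x v|`, which does not depend on the
        -- approximating matrix.
        (sum-nonneg _ λ i → sum-nonneg _ λ j → abs-nonneg (x (element i) * x (element j)))
        λ ε 0<ε → estimate (approximations 0<ε)
        where
        estimate : ∀ {ε} → Approximation ε →
                0# ≤ ∑ ℝ finite (λ u → ∑ ℝ finite λ v → x u * C u v * x v)
                   + ε * ∑ ℝ finite (λ u → ∑ ℝ finite λ v → abs (x u * x v))
        estimate {ε} ((_ , (M , psd , _) , _) , _ , near) = ≤-trans (nonneg psd x)
          (sum-≤ ε λ i → sum-≤ ε λ j → entry (element i) (element j))
          where
          entry : ∀ u v → x u * M u v * x v ≤ x u * C u v * x v + ε * abs (x u * x v)
          entry u v = ≤-resp-≈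
            (solve 3 (λ a b m → a :* b :* m := a :* m :* b) refl (x u) (x v) (M u v))
            (+-congʳ (solve 3 (λ a b m → a :* b :* m := a :* m :* b) refl (x u) (x v) (C u v)))
            (near-*ˡ (x u * x v) (near u v))

    feasibleθ : Feasible θ
    feasibleθ = C , C-psd , (λ v → antisym (diagonal≤ v) (diagonal≥ v)) , λ u~v → antisym (edge≤ u~v) (edge≥ u~v)
      where
      ε≈ε*1 : ∀ {x ε} → x + ε ≈ x + ε * 1#
      ε≈ε*1 = +-congˡ (sym (*-identityʳ _))

      diagonal≤ : ∀ v → C v v ≤ θ - 1#
      -- One `ε` comes from the entry and one from `l ≤ θ + ε`. The reverse bound needs only the
      -- first, because `θ ≤ l` holds exactly.
      diagonal≤ v = ≤-limit em 0≤2 λ ε 0<ε → estimate (approximations 0<ε)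
        where
        estimate : ∀ {ε} → Approximation ε →
                C v v ≤ θ - 1# + ε * 2#
        estimate {ε} ((l , (M , _ , diagonal , _) , _) , l≤θ+ε , near) = ≤-trans (proj₂ (near v v))
          (≤-resp-≈ (+-congʳ (sym (diagonal v)))
            (solve 2 (λ t e → t :+ e :- con (+ 1) :+ e := t :- con (+ 1) :+ e :* (con (+ 1) :+ con (+ 1)))
              refl θ ε)
            (+-monoˡ-≤ ε (+-monoˡ-≤ (- 1#) l≤θ+ε)))

      diagonal≥ : ∀ v → θ - 1# ≤ C v v
      diagonal≥ v = ≤-limit em 0≤1 λ ε 0<ε → estimate (approximations 0<ε)
        where
        estimate : ∀ {ε} → Approximation ε →
                θ - 1# ≤ C v v + ε * 1#
        estimate ((l , fl@(M , _ , diagonal , _) , _) , _ , near) = ≤-trans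
          (+-monoˡ-≤ (- 1#) (proj₁ isInfimum l fl))
          (≤-resp-≈ (diagonal v) ε≈ε*1 (proj₁ (near v v)))

      edge≤ : ∀ {u v} → Adj u v → C u v ≤ - 1#
      edge≤ {u} {v} u~v = ≤-limit em 0≤1 λ ε 0<ε → estimate (approximations 0<ε)
        where
        estimate : ∀ {ε} → Approximation ε →
                C u v ≤ - 1# + ε * 1#
        estimate ((_ , (_ , _ , _ , edge) , _) , _ , near) =
          ≤-respʳ-≈ (trans (+-congʳ (edge u~v)) ε≈ε*1) (proj₂ (near u v))

      edge≥ : ∀ {u v} → Adj u v → - 1# ≤ C u v
      edge≥ {u} {v} u~v = ≤-limit em 0≤1 λ ε 0<ε → estimate (approximations 0<ε)
        where
        estimate : ∀ {ε} → Approximation ε →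
                - 1# ≤ C u v + ε * 1#
        estimate ((_ , (_ , _ , _ , edge) , _) , _ , near) =
          ≤-resp-≈ (edge u~v) ε≈ε*1 (proj₁ (near u v))

  minimum : ∃ (IsComplementTheta ℝ H finite)
  minimum = proj₁ greatest , feasibleθ feasible-N (proj₂ greatest) , proj₁ (proj₂ greatest)
    where
    greatest : ∃ (IsInfimum Feasible)
    greatest = infimum Feasible (N , feasible-N) (1# , λ _ → 1≤feasible)

-- Gram matrices of finite families of vectors.

module GramMatrices (ℝ : CompleteOrderedField) (H : InnerProductSpace ℝ) where
  open CompleteOrderedField ℝ hiding (zero)
  open QuadraticForms ℝ
  open IntegerCoefficients commutativeRing
  open SemiringSum semiring using (sum; sum-cong-≋)
  open InnerProductSpace H
  open SetoidReasoning setoid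

  ⟨⟩-zeroˡ : ∀ z → ⟨ 0ᴹ , z ⟩ ≈ 0#
  ⟨⟩-zeroˡ z = begin
    ⟨ 0ᴹ , z ⟩        ≈⟨ ⟨⟩-cong (*ₗ-zeroˡ 0ᴹ) ≈ᴹ-refl ⟨
    ⟨ 0# *ₗ 0ᴹ , z ⟩  ≈⟨ ⟨⟩-* 0# 0ᴹ z ⟩
    0# * ⟨ 0ᴹ , z ⟩   ≈⟨ zeroˡ _ ⟩
    0#                ∎

  ⟨⟩-neg² : ∀ x y → ⟨ -ᴹ x , -ᴹ y ⟩ ≈ ⟨ x , y ⟩
  ⟨⟩-neg² x y = begin
    ⟨ -ᴹ x , -ᴹ y ⟩  ≈⟨ ⟨⟩-negʳ (-ᴹ x) y ⟩
    - ⟨ -ᴹ x , y ⟩   ≈⟨ -‿cong (⟨⟩-sym (-ᴹ x) y) ⟩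
    - ⟨ y , -ᴹ x ⟩   ≈⟨ -‿cong (⟨⟩-negʳ y x) ⟩
    - - ⟨ y , x ⟩    ≈⟨ -‿involutive _ ⟩
    ⟨ y , x ⟩        ≈⟨ ⟨⟩-sym y x ⟩
    ⟨ x , y ⟩        ∎

  combination : ∀ {n} → (Fin n → Carrier) → (Fin n → Carrierᴹ) → Carrierᴹ
  combination x w = foldr _+ᴹ_ 0ᴹ λ i → x i *ₗ w i

  ⟨combination⟩ : ∀ {n} (x : Fin n → Carrier) w z →
                  ⟨ combination x w , z ⟩ ≈ sum (λ i → x i * ⟨ w i , z ⟩)
  ⟨combination⟩ {zero}  x w z = ⟨⟩-zeroˡ z
  ⟨combination⟩ {suc n} x w z = trans (⟨⟩-+ _ _ z)
    (+-cong (⟨⟩-* (x zero) (w zero) z) (⟨combination⟩ (λ i → x (suc i)) (λ i → w (suc i)) z))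

  -- Bilinear expansion of a squared norm; this is why Gram matrices are positive semidefinite.
  form-gram : ∀ {n} (w : Fin n → Carrierᴹ) x →
              form (λ i j → ⟨ w i , w j ⟩) x x ≈ ⟨ combination x w , combination x w ⟩
  form-gram w x = begin
    form (λ i j → ⟨ w i , w j ⟩) x x
      ≈⟨ sum-cong-≋ (λ i → trans
           (scale-sum (x i) (λ j → x j * ⟨ w j , w i ⟩) _ λ j → trans
             (*-congʳ (*-congˡ (⟨⟩-sym (w i) (w j))))
             (solve 3 (λ a m b → a :* m :* b := a :* (b :* m)) refl (x i) ⟨ w j , w i ⟩ (x j)))
           (*-congˡ (trans (sym (⟨combination⟩ x w (w i))) (⟨⟩-sym _ (w i))))) ⟩
    sum (λ i → x i * ⟨ w i , combination x w ⟩)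
      ≈⟨ ⟨combination⟩ x w (combination x w) ⟨
    ⟨ combination x w , combination x w ⟩ ∎

-- From homomorphisms into a sphere to feasible matrices.

module SphereToMatrix (ℝ : CompleteOrderedField) where
  open CompleteOrderedField ℝ hiding (zero)
  open OrderedField ℝ
  open QuadraticForms ℝ
  open IntegerCoefficients commutativeRing
  open SetoidReasoning setoid

  module _ (H₊ H₋ : InnerProductSpace ℝ) where
    open OrthogonalSum ℝ H₊ H₋
    private
      module H₊ = InnerProductSpace H₊
      module H₋ = InnerProductSpace H₋
      module G₊ = GramMatrices ℝ H₊
      module G₋ = GramMatrices ℝ H₋

    gram-psd : ∀ {V} (finite : Finite V) (y : V → 𝓗) c → 0# ≤ c →
               PositiveSemidefinite ℝ finite (λ u v → c * ⟪ y u , y v ⟫)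
    gram-psd finite y c 0≤c = record
      { symmetric = λ u v → *-congˡ (⟪⟫-sym (y u) (y v))
      ; nonneg    = λ x → ≤-respʳ-≈ (sym (value (λ i → x (element i))))
          (*-nonneg 0≤c (+-nonneg (H₊.nonneg _) (H₋.nonneg _)))
      }
      where
      open Finite finite
      y₊ = λ i → proj₁ (y (element i))
      y₋ = λ i → proj₂ (y (element i))

      value : ∀ x → form (onIndices finite (λ u v → c * ⟪ y u , y v ⟫)) x x ≈
                    c * (H₊.⟨ G₊.combination x y₊ , G₊.combination x y₊ ⟩
                       + H₋.⟨ G₋.combination x y₋ , G₋.combination x y₋ ⟩)
      value x = trans (form-*ᴹ (onIndices finite (λ u v → ⟪ y u , y v ⟫)) c x x) (*-congˡ (trans
        (form-+ᴹ (λ i j → H₊.⟨ y₊ i , y₊ j ⟩) (λ i j → H₋.⟨ y₋ i , y₋ j ⟩) x x)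
        (+-cong (G₊.form-gram y₊ x) (G₋.form-gram y₋ x))))

    reflect : Sign → 𝓗 → 𝓗
    reflect pos x = x
    reflect neg x = R x

    R-isometry : ∀ x y → ⟪ R x , R y ⟫ ≈ ⟪ x , y ⟫
    R-isometry (a , b) (c , d) = +-congˡ (G₋.⟨⟩-neg² b d)

    reflect-isometry : ∀ s x y → ⟪ reflect s x , reflect s y ⟫ ≈ ⟪ x , y ⟫
    reflect-isometry pos x y = refl
    reflect-isometry neg x y = R-isometry x y

    -- Since `R` is a self-adjoint isometry, the inner product depends only on `s · r`. For `s · r`
    -- positive it is `⟪ x , y ⟫`, which governs negative edges; hence the `opposite`.
    reflect-edge : ∀ {t} (1≤t : 1# ≤ t) s r {x y} →
                   SignedGraph.Edge (signedSphere ℝ t 1≤t H₊ H₋) (opposite (s · r)) x y →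
                   ⟪ reflect s (proj₁ x) , reflect r (proj₁ y) ⟫ ≈ γ ℝ t
    reflect-edge 1≤t pos pos e = e
    reflect-edge 1≤t pos neg e = e
    reflect-edge 1≤t neg pos {x , _} {y , _} e =
      trans (⟪⟫-sym (R x) y) (trans (sym (R-selfAdjoint x y)) e)
    reflect-edge 1≤t neg neg {x , _} {y , _} e = trans (R-isometry x y) e

  -- The second end of a conflict edge carries `opposite σ · s`. The two copies of `s` cancel, as do
  -- the two sign reversals, leaving the sign that `preserves` delivers.
  switched-sign : ∀ τ τ′ σ s → opposite (s · τ · (opposite σ · s · τ′)) ≡ τ · σ · τ′
  switched-sign pos pos pos pos = ≡.refl
  switched-sign pos pos pos neg = ≡.refl
  switched-sign pos pos neg pos = ≡.refl
  switched-sign pos pos neg neg = ≡.refl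
  switched-sign pos neg pos pos = ≡.refl
  switched-sign pos neg pos neg = ≡.refl
  switched-sign pos neg neg pos = ≡.refl
  switched-sign pos neg neg neg = ≡.refl
  switched-sign neg pos pos pos = ≡.refl
  switched-sign neg pos pos neg = ≡.refl
  switched-sign neg pos neg pos = ≡.refl
  switched-sign neg pos neg neg = ≡.refl
  switched-sign neg neg pos pos = ≡.refl
  switched-sign neg neg pos neg = ≡.refl
  switched-sign neg neg neg pos = ≡.refl
  switched-sign neg neg neg neg = ≡.refl

  1≤2t-1 : ∀ {t} → 1# ≤ t → 1# ≤ 2# * t - 1#
  1≤2t-1 {t} 1≤t = ≤-by-gap (*-nonneg 0≤2 (x≤y⇒0≤y-x 1≤t))
    (solve 1 (λ t → con (+ 1) :+ (con (+ 1) :+ con (+ 1)) :* (t :- con (+ 1))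
                 := (con (+ 1) :+ con (+ 1)) :* t :- con (+ 1)) refl t)

  -- The scaling `2# * t - 1#` thus sends the inner product on edges to `- 1#`, and unit norm to the
  -- diagonal required for the value `2# * t`.
  [2t-1]γ≈-1 : ∀ {t} → 1# ≤ t → (2# * t - 1#) * γ ℝ t ≈ - 1#
  [2t-1]γ≈-1 {t} 1≤t = begin
    (2# * t - 1#) * γ ℝ t       ≈⟨ solve 2 (λ s g → (s :- con (+ 1)) :* g := :- ((con (+ 1) :- s) :* g)) refl (2# * t) (γ ℝ t) ⟩
    - ((1# - 2# * t) * γ ℝ t)   ≈⟨ -‿cong (*-inverseʳ 1-2t≉0) ⟩
    - 1#                        ∎
    where
    1-2t≉0 : ¬ 1# - 2# * t ≈ 0#
    1-2t≉0 1-2t≈0 = 1≤x⇒0<x (1≤2t-1 1≤t) (≤-reflexive (begin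
      2# * t - 1#     ≈⟨ solve 1 (λ s → s :- con (+ 1) := :- (con (+ 1) :- s)) refl (2# * t) ⟩
      - (1# - 2# * t) ≈⟨ -‿cong 1-2t≈0 ⟩
      - 0#            ≈⟨ solve 0 (:- con (+ 0) := con (+ 0)) refl ⟩
      0#              ∎))

  thetaFeasible : (G : SignedGraph) (finite : Finite (SignedGraph.V G)) → ∀ {t} →
                  BalancedFeasible ℝ G t →
                  ThetaFeasible ℝ (conflictGraph G) (×Sign-finite finite) (2# * t)
  thetaFeasible G finite {t} (1≤t , H₊ , H₋ , h) =
    (λ u v → c * ⟪ y u , y v ⟫) ,
    gram-psd H₊ H₋ (×Sign-finite finite) y c (≤-trans 0≤1 (1≤2t-1 1≤t)) ,
    (λ v → trans (*-congˡ (unit v)) (*-identityʳ c)) ,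
    λ u~v → trans (*-congˡ (edge u~v)) ([2t-1]γ≈-1 1≤t)
    where
    open SignedGraph G using (V)
    open SignedHomomorphism h
    open OrthogonalSum ℝ H₊ H₋
    c = 2# * t - 1#

    y : V × Sign → 𝓗
    y (v , s) = reflect H₊ H₋ (s · τ v) (proj₁ (f v))

    unit : ∀ v → ⟪ y v , y v ⟫ ≈ 1#
    unit (v , s) = trans (reflect-isometry H₊ H₋ (s · τ v) (proj₁ (f v)) (proj₁ (f v)))
      (trans (sym (proj₂ (proj₁ (proj₂ (f v))))) (*-identityˡ 1#))

    edge : ∀ {u v} → SimpleGraph.Adj (conflictGraph G) u v → ⟪ y u , y v ⟫ ≈ γ ℝ t
    edge {u , s} {v , r} (σ , e , ≡.refl) =
      reflect-edge H₊ H₋ 1≤t (s · τ u) (opposite σ · s · τ v) {f u} {f v}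
        (≡.subst (λ z → SignedGraph.Edge (signedSphere ℝ t 1≤t H₊ H₋) z (f u) (f v))
          (≡.sym (switched-sign (τ u) (τ v) σ s)) (preserves e))

-- From feasible matrices to homomorphisms into a sphere.

module MatrixToSphere (em : ExcludedMiddle 0ℓ) (ℝ : CompleteOrderedField)
                      (G : SignedGraph) (finite : Finite (SignedGraph.V G))
                      (v₀ : SignedGraph.V G) where
  open CompleteOrderedField ℝ hiding (zero)
  open OrderedField ℝ
  open QuadraticForms ℝ
  open IntegerCoefficients commutativeRing
  open SemiringSum semiring using (sum; sum-cong-≋; ∑-distrib-+)
  open SetoidReasoning setoid
  open SignedGraph (completion G) using (V; Edge)
  open Finite finite

  -- The enumeration of `V × Sign` lists the two signs of each vertex consecutively, so the sum
  -- regroups into adjacent pairs.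
  sum-×Sign : ∀ n (h : Fin n × Fin 2 → Carrier) →
              sum (λ i → h (remQuot {n} 2 i)) ≈ sum (λ i → h (i , zero) + h (i , suc zero))
  sum-×Sign zero    h = refl
  sum-×Sign (suc n) h = trans (sym (+-assoc _ _ _))
    (+-congˡ (sum-×Sign n (λ (i , j) → h (suc i , j))))

  ∑-×Sign : ∀ g → ∑ ℝ (×Sign-finite finite) g ≈ ∑ ℝ finite (λ v → g (v , pos) + g (v , neg))
  ∑-×Sign g = sum-×Sign size (λ (i , j) → g (element i , Inverse.to Sign-enum j))

  ∑-cong : ∀ {f g : V → Carrier} → (∀ v → f v ≈ g v) → ∑ ℝ finite f ≈ ∑ ℝ finite g
  ∑-cong f≈g = sum-cong-≋ λ i → f≈g (element i)

  module _ {l} (feasible : ThetaFeasible ℝ (conflictGraph G) (×Sign-finite finite) l) where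
    private
      M = proj₁ feasible

    open PositiveSemidefinite (proj₁ (proj₂ feasible))

    diagonal : ∀ v → M v v ≈ l - 1#
    diagonal = proj₁ (proj₂ (proj₂ feasible))

    edge : ∀ {u v} → SimpleGraph.Adj (conflictGraph G) u v → M u v ≈ - 1#
    edge = proj₂ (proj₂ (proj₂ feasible))

    -- Up to the factor 2, the entries ((u , +) , (v , ±)) of the average of M over the
    -- involution (v , s) ↦ (v , − s).
    aligned opposed : V → V → Carrier
    aligned u v = M (u , pos) (v , pos) + M (u , neg) (v , neg)
    opposed u v = M (u , pos) (v , neg) + M (u , neg) (v , pos)

    -- The positive loop at `v₀` makes its two copies adjacent, so an entry `- 1#` occurs; it is at
    -- least `- (l - 1#)`.
    1≤l-1 : 1# ≤ l - 1#
    1≤l-1 = ≤-resp-≈ (-‿involutive 1#) (-‿involutive (l - 1#)) (negate-≤ (≤-respʳ-≈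
      (edge {v₀ , pos} {v₀ , neg} (pos , inj₂ (≡.refl , ≡.refl) , ≡.refl))
      (proj₁ (ThetaAttained.feasible-entry em ℝ (conflictGraph G) (×Sign-finite finite) (v₀ , pos)
               feasible (v₀ , pos) (v₀ , neg)))))
      where
      negate-≤ : ∀ {x y} → x ≤ y → - y ≤ - x
      negate-≤ {x} {y} x≤y = ≤-by-gap (x≤y⇒0≤y-x x≤y)
        (solve 2 (λ x y → :- y :+ (y :- x) := :- x) refl x y)

    0<4[l-1] : 0< (2# * (2# * (l - 1#)))
    0<4[l-1] = 1≤x⇒0<x (1≤2x (1≤2x 1≤l-1))
      where
      1≤2x : ∀ {x} → 1# ≤ x → 1# ≤ 2# * x
      1≤2x 1≤x = ≤-trans 1≤2 (≤-respˡ-≈ (*-identityʳ 2#) (*-monoˡ-≤ 2# 0≤2 1≤x))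

    -- Normalises the points: without it their squared norm would be `2# * aligned v v`, that is,
    -- four times `l - 1#`.
    κ : Carrier
    κ = (2# * (2# * (l - 1#))) ⁻¹

    4[l-1]κ≈1 : 2# * (2# * (l - 1#)) * κ ≈ 1#
    4[l-1]κ≈1 = *-inverseʳ (0<x⇒x≉0 0<4[l-1])

    -- Here `c` is the eigenvalue of the involution: `1#` yields the even block and `- 1#` the odd
    -- one.
    block : Carrier → V → V → Carrier
    block c u v = κ * (aligned u v + c * opposed u v)

    -- The quadratic form of the block is that of M on the vectors (v , +) ↦ x v,
    -- (v , −) ↦ c x v.
    block-psd : ∀ c → c * c ≈ 1# → PositiveSemidefinite ℝ finite (block c)
    block-psd c cc≈1 = record
      { symmetric = λ u v → *-congˡ (+-cong
          (+-cong (symmetric (u , pos) (v , pos)) (symmetric (u , neg) (v , neg)))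
          (*-congˡ (trans (+-cong (symmetric (u , pos) (v , neg)) (symmetric (u , neg) (v , pos)))
                          (+-comm _ _))))
      ; nonneg    = λ x → ≤-respʳ-≈ (sym (value x))
          (*-nonneg (⁻¹-nonneg 0<4[l-1]) (nonneg (lift x)))
      }
      where
      lift : (V → Carrier) → V × Sign → Carrier
      lift x (v , pos) = x v
      lift x (v , neg) = c * x v

      entry : ∀ x u v →
        (lift x (u , pos) * M (u , pos) (v , pos) * lift x (v , pos)
         + lift x (u , pos) * M (u , pos) (v , neg) * lift x (v , neg))
        + (lift x (u , neg) * M (u , neg) (v , pos) * lift x (v , pos)
         + lift x (u , neg) * M (u , neg) (v , neg) * lift x (v , neg))
        ≈ x u * (aligned u v + c * opposed u v) * x v
      entry x u v = begin
        -- The entry at two negative copies acquires the factor `c * c`, which is why `c` must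
        -- square to `1#`.
        _ ≈⟨ solve 7 (λ a b c p q r s →
               (a :* p :* b :+ a :* q :* (c :* b)) :+ ((c :* a) :* r :* b :+ (c :* a) :* s :* (c :* b))
               := a :* (p :+ (c :* c) :* s :+ c :* (q :+ r)) :* b)
             refl (x u) (x v) c (M (u , pos) (v , pos)) (M (u , pos) (v , neg))
                  (M (u , neg) (v , pos)) (M (u , neg) (v , neg)) ⟩
        x u * (M (u , pos) (v , pos) + c * c * M (u , neg) (v , neg) + c * opposed u v) * x v
          ≈⟨ *-congʳ (*-congˡ (+-congʳ (+-congˡ (trans (*-congʳ cc≈1) (*-identityˡ _))))) ⟩
        x u * (aligned u v + c * opposed u v) * x v ∎

      lifted : ∀ x → ∑ ℝ (×Sign-finite finite) (λ u → ∑ ℝ (×Sign-finite finite) λ v →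
                       lift x u * M u v * lift x v)
                     ≈ ∑ ℝ finite (λ u → ∑ ℝ finite λ v → x u * (aligned u v + c * opposed u v) * x v)
      lifted x = trans (∑-×Sign (λ u → ∑ ℝ (×Sign-finite finite) (λ v → g u v)))
        (∑-cong λ u → trans (+-cong (∑-×Sign (g (u , pos))) (∑-×Sign (g (u , neg))))
          (trans (sym (∑-distrib-+ (λ i → g (u , pos) (element i , pos) + g (u , pos) (element i , neg))
                                   (λ i → g (u , neg) (element i , pos) + g (u , neg) (element i , neg))))
                 (∑-cong λ v → entry x u v)))
        where
        g : V × Sign → V × Sign → Carrier
        g u v = lift x u * M u v * lift x v

      value : ∀ x → ∑ ℝ finite (λ u → ∑ ℝ finite λ v → x u * block c u v * x v)
                    ≈ κ * ∑ ℝ (×Sign-finite finite) (λ u → ∑ ℝ (×Sign-finite finite) λ v →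
                            lift x u * M u v * lift x v)
      value x = trans
        (form-*ᴹ (onIndices finite (λ u v → aligned u v + c * opposed u v)) κ
          (λ i → x (element i)) (λ i → x (element i)))
        (*-congˡ (sym (lifted x)))

    space : ∀ c → c * c ≈ 1# → InnerProductSpace ℝ
    space c cc≈1 = gramSpace (PSD-onIndices finite (block-psd c cc≈1)) em

    e : V → Fin size → Carrier
    e v = δ (index finite v)

    ⟨e,e⟩ : ∀ c cc≈1 u v → InnerProductSpace.⟨_,_⟩ (space c cc≈1) (e u) (e v) ≈ block c u v
    ⟨e,e⟩ c cc≈1 u v = trans
      (form-δ (onIndices finite (block c)) (index finite u) (index finite v))
      (reflexive (≡.cong₂ (block c) (element-index finite u) (element-index finite v)))

    -1*-1≈1 : - 1# * - 1# ≈ 1#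
    -1*-1≈1 = solve 0 ((:- con (+ 1)) :* (:- con (+ 1)) := con (+ 1)) refl

    H₊ H₋ : InnerProductSpace ℝ
    H₊ = space 1# (*-identityˡ 1#)
    H₋ = space (- 1#) -1*-1≈1

    open OrthogonalSum ℝ H₊ H₋

    -- The same basis vector in both blocks: adding their inner products cancels `opposed`, while
    -- `R` turns the sum into a difference and cancels `aligned`.
    point : V → 𝓗
    point v = e v , e v

    ⟪point,point⟫ : ∀ u v → ⟪ point u , point v ⟫ ≈ κ * (2# * aligned u v)
    ⟪point,point⟫ u v = trans
      (+-cong (⟨e,e⟩ 1# (*-identityˡ 1#) u v) (⟨e,e⟩ (- 1#) -1*-1≈1 u v))
      (solve 3 (λ k p q → k :* (p :+ con (+ 1) :* q) :+ k :* (p :+ (:- con (+ 1)) :* q)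
                       := k :* ((con (+ 1) :+ con (+ 1)) :* p))
        refl κ (aligned u v) (opposed u v))

    ⟪point,Rpoint⟫ : ∀ u v → ⟪ point u , R (point v) ⟫ ≈ κ * (2# * opposed u v)
    ⟪point,Rpoint⟫ u v = trans
      (+-cong (⟨e,e⟩ 1# (*-identityˡ 1#) u v)
              (trans (InnerProductSpace.⟨⟩-negʳ H₋ (e u) (e v)) (-‿cong (⟨e,e⟩ (- 1#) -1*-1≈1 u v))))
      (solve 3 (λ k p q → k :* (p :+ con (+ 1) :* q) :- k :* (p :+ (:- con (+ 1)) :* q)
                       := k :* ((con (+ 1) :+ con (+ 1)) :* q))
        refl κ (aligned u v) (opposed u v))

    norm : ∀ v → ‖ point v ‖≈ 1#
    norm v = 0≤1 , sym (begin
      ⟪ point v , point v ⟫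
        ≈⟨ ⟪point,point⟫ v v ⟩
      κ * (2# * aligned v v)
        ≈⟨ *-congˡ (*-congˡ (+-cong (diagonal (v , pos)) (diagonal (v , neg)))) ⟩
      κ * (2# * (l - 1# + (l - 1#)))
        ≈⟨ solve 2 (λ k d → k :* ((con (+ 1) :+ con (+ 1)) :* (d :+ d))
             := (con (+ 1) :+ con (+ 1)) :* ((con (+ 1) :+ con (+ 1)) :* d) :* k) refl κ (l - 1#) ⟩
      2# * (2# * (l - 1#)) * κ
        ≈⟨ 4[l-1]κ≈1 ⟩
      1#
        ≈⟨ *-identityˡ 1# ⟨
      1# * 1# ∎)

    2½l≈l : 2# * (½ * l) ≈ l
    2½l≈l = trans (sym (*-assoc 2# ½ l)) (trans (*-congʳ 2½≈1) (*-identityˡ l))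

    -- Two entries `- 1#` add up to `x`, so the left side is `-1 / (l - 1)`, which is `γ` at half of
    -- `l`.
    κ-edge : ∀ {x} → x ≈ - 1# + - 1# → κ * (2# * x) ≈ γ ℝ (½ * l)
    κ-edge {x} x≈-2 = ⁻¹-unique
      (λ 1-2½l≈0 → 0<x⇒x≉0 (1≤x⇒0<x 1≤l-1) (begin
        l - 1#                 ≈⟨ solve 1 (λ l → l :- con (+ 1) := :- (con (+ 1) :- l)) refl l ⟩
        - (1# - l)             ≈⟨ -‿cong (+-congˡ (-‿cong 2½l≈l)) ⟨
        - (1# - 2# * (½ * l))  ≈⟨ -‿cong 1-2½l≈0 ⟩
        - 0#                   ≈⟨ solve 0 (:- con (+ 0) := con (+ 0)) refl ⟩
        0#                     ∎))
      (begin
        (1# - 2# * (½ * l)) * (κ * (2# * x))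
          ≈⟨ *-cong (+-congˡ (-‿cong 2½l≈l)) (*-congˡ (*-congˡ x≈-2)) ⟩
        (1# - l) * (κ * (2# * (- 1# + - 1#)))
          ≈⟨ solve 2 (λ k l → (con (+ 1) :- l) :* (k :* ((con (+ 1) :+ con (+ 1)) :* (:- con (+ 1) :+ :- con (+ 1))))
               := (con (+ 1) :+ con (+ 1)) :* ((con (+ 1) :+ con (+ 1)) :* (l :- con (+ 1))) :* k) refl κ l ⟩
        2# * (2# * (l - 1#)) * κ
          ≈⟨ 4[l-1]κ≈1 ⟩
        1# ∎)

    -- A positive edge joins copies of opposite sign, in both ways, so both summands of `opposed`
    -- are `- 1#`. A negative edge joins copies of equal sign and does the same for `aligned`.
    positive-edge : ∀ {u v} → Edge pos u v → ⟪ point u , R (point v) ⟫ ≈ γ ℝ (½ * l)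
    positive-edge {u} {v} uv = trans (⟪point,Rpoint⟫ u v)
      (κ-edge (+-cong (edge (pos , uv , ≡.refl)) (edge (pos , uv , ≡.refl))))

    negative-edge : ∀ {u v} → Edge neg u v → ⟪ point u , point v ⟫ ≈ γ ℝ (½ * l)
    negative-edge {u} {v} uv = trans (⟪point,point⟫ u v)
      (κ-edge (+-cong (edge (neg , uv , ≡.refl)) (edge (neg , uv , ≡.refl))))

    1≤½l : 1# ≤ ½ * l
    1≤½l = 0≤y-x⇒x≤y (*-cancelˡ-nonneg 0<2 (≤-respʳ-≈ (begin
      l - 1# - 1#               ≈⟨ +-congʳ (+-congʳ 2½l≈l) ⟨
      2# * (½ * l) - 1# - 1#    ≈⟨ solve 1 (λ h → (con (+ 1) :+ con (+ 1)) :* h :- con (+ 1) :- con (+ 1)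
                                     := (con (+ 1) :+ con (+ 1)) :* (h :- con (+ 1))) refl (½ * l) ⟩
      2# * (½ * l - 1#)         ∎)
      (x≤y⇒0≤y-x 1≤l-1)))

    balancedFeasible : BalancedFeasible ℝ G (½ * l)
    balancedFeasible = 1≤½l , H₊ , H₋ , record
      { τ         = λ _ → pos
      -- The positive loop adjoined at `v` supplies the condition `⟪ x , R x ⟫ ≈ γ` on vertices of
      -- the sphere.
      ; f         = λ v → point v , norm v , positive-edge (inj₂ (≡.refl , ≡.refl))
      ; preserves = λ { {pos} → positive-edge ; {neg} → negative-edge }
      }

theorem6p1 : ExcludedMiddle 0ℓ →
    (ℝ : CompleteOrderedField) (let open CompleteOrderedField ℝ) →
    (G : SignedGraph) (finite : Finite (SignedGraph.V G)) →
    (nonempty : SignedGraph.V G) →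
    ∃₂ λ (b θ : Carrier) →
    IsBalancedTheta ℝ G b ×
    IsComplementTheta ℝ (conflictGraph G) (×Sign-finite finite) θ ×
    b ≈ ½ * θ
theorem6p1 em ℝ G finite v₀ =
  ½ * θ , θ , (lower , greatest) , proj₂ minimum , refl
  where
  open CompleteOrderedField ℝ
  open OrderedField ℝ
  open ThetaAttained em ℝ (conflictGraph G) (×Sign-finite finite) (v₀ , pos) using (minimum)

  θ = proj₁ minimum

  lower : ∀ t → BalancedFeasible ℝ G t → ½ * θ ≤ t
  lower t feasible = ≤-respʳ-≈
    (trans (sym (*-assoc ½ 2# t)) (trans (*-congʳ (trans (*-comm ½ 2#) 2½≈1)) (*-identityˡ t)))
    (*-monoˡ-≤ ½ (⁻¹-nonneg 0<2)
      (proj₂ (proj₂ minimum) (2# * t) (SphereToMatrix.thetaFeasible ℝ G finite feasible)))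

  greatest : ∀ l → (∀ t → BalancedFeasible ℝ G t → l ≤ t) → l ≤ ½ * θ
  -- The infimum is attained: the minimising matrix makes `½ * θ` itself feasible.
  greatest l below = below (½ * θ)
    (MatrixToSphere.balancedFeasible em ℝ G finite v₀ (proj₁ (proj₂ minimum)))
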